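{- Let $T$ denote the set of nonnegative integers for which the sum of any two consecutive digits in the base-$3$ expansion is always less than $3$. Let $T'=\{t\in T : t\not\equiv 2 \pmod 3\}$. Then for every integer $n\ge 1$, one has $e_3(n-1,n)=s_3(n)$ if and only if $$n\in (3T+1)\cup(3T'+2)\cup(9T+3).$$
   Context: For integers $a,b$ and a set $A$ of integers, $aA+b=\{at+b : t\in A\}$. $\nu_3(m)$ denotes the exponent of $3$ in the integer $m$, with $\nu_3(0)=\infty$; $[x]$ is the integer part of $x$. For integers $k\ge 0$ and $j\ge 0$ define the partial Stirling number $a_3(k,j)=\sum_{i\not\equiv 0\ (\mathrm{mod}\ 3)}(-1)^i\binom{j}{i}i^k$. For $k\ge 0$, $n\ge 1$ define $e_3(k,n)=\min\{\nu_3(a_3(k,j)) : j\ge n\}$. Define $s_3(n)=n-1+\nu_3([n/3]!)$. Integers with a one-digit base-$3$ expansion satisfy the digit condition vacuously. -}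

module Defs where

open import Level using (0ℓ)
open import Data.Digit using (toDigits)
open import Data.Fin.Base using (toℕ)
open import Data.Integer.Base as ℤ using (ℤ; +_; -1ℤ; 0ℤ; ∣_∣)
open import Data.List.Base using (foldr; map; filter; upTo)
open import Data.List.Relation.Unary.Linked using (Linked)
open import Data.Nat.Base
open import Data.Nat.Combinatorics using (_C_)
open import Data.Nat.Divisibility
  using (_∣_; _∣?_; divides; 1∣_; *-monoʳ-∣; *-cancelˡ-∣)
import Data.Nat.Properties as ℕ
open import Data.Product.Base using (∃-syntax; _×_; proj₁)
open import Relation.Binary.PropositionalEquality
  using (_≡_; _≢_; sym; trans; subst)
open import Relation.Nullary using (¬_; ¬?; yes; no)
open import Relation.Nullary.Construct.Add.Supremum using (_⁺; ⊤⁺; [_])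
open import Relation.Unary using (Pred; _∈_; _∩_)

ℕ∞ : Set
ℕ∞ = ℕ ⁺

open import Relation.Binary.Construct.Add.Supremum.NonStrict _≤_ public
  using () renaming (_≤⁺_ to _≤∞_)

infixl 6 _+∞_
_+∞_ : ℕ∞ → ℕ∞ → ℕ∞
[ a ] +∞ [ b ] = [ a + b ]
[ _ ] +∞ ⊤⁺    = ⊤⁺
⊤⁺    +∞ _     = ⊤⁺

-- The number of times m can be divided by 3, cut off at `fuel`.  For m ≥ 1,
-- fuel m suffices, so that the result is the exact exponent of 3 in m: see
-- 3^exponent₃∣m and 3^[1+exponent₃]∤m.
exponent₃ : (fuel m : ℕ) → ℕ
exponent₃ zero       m = 0
exponent₃ (suc fuel) m with 3 ∣? m
... | yes (divides q _) = suc (exponent₃ fuel q)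
... | no  _             = 0

ν₃ : ℤ → ℕ∞
ν₃ z with ∣ z ∣
... | zero      = ⊤⁺
... | m@(suc _) = [ exponent₃ m m ]

3^exponent₃∣m : ∀ fuel m → 3 ^ exponent₃ fuel m ∣ m
3^exponent₃∣m zero       m = 1∣ m
3^exponent₃∣m (suc fuel) m with 3 ∣? m
... | no  _               = 1∣ m
... | yes (divides q m≡q*3) =
  subst (3 ^ suc (exponent₃ fuel q) ∣_) (sym (trans m≡q*3 (ℕ.*-comm q 3)))
        (*-monoʳ-∣ 3 (3^exponent₃∣m fuel q))

3^[1+exponent₃]∤m : ∀ fuel m → .{{NonZero m}} → m ≤ fuel →
                    ¬ 3 ^ suc (exponent₃ fuel m) ∣ m
3^[1+exponent₃]∤m (suc fuel) (suc m) m≤fuel 3^∣m with 3 ∣? suc m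
... | no  3∤m                        = 3∤m 3^∣m
... | yes (divides q@(suc _) m≡q*3) =
  3^[1+exponent₃]∤m fuel q
    (s≤s⁻¹ (ℕ.≤-trans (subst (q <_) (sym m≡q*3) (ℕ.m<m*n q 3 (s≤s (s≤s z≤n)))) m≤fuel))
    (*-cancelˡ-∣ 3 (subst (3 ^ suc (suc (exponent₃ fuel q)) ∣_)
                          (trans m≡q*3 (ℕ.*-comm q 3)) 3^∣m))

-- a₃(k,j) = ∑_{i ≢ 0 mod 3} (-1)^i (j choose i) i^k; the terms with i > j
-- vanish, so the sum is taken over 0 ≤ i ≤ j.
a₃ : (k j : ℕ) → ℤ
a₃ k j = foldr ℤ._+_ 0ℤ (map term (filter (λ i → ¬? (i % 3 ℕ.≟ 0)) (upTo (suc j))))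
  where
  term : ℕ → ℤ
  term i = -1ℤ ℤ.^ i ℤ.* + (j C i) ℤ.* (+ i) ℤ.^ k

_IsMinimumOf_ : ℕ∞ → Pred ℕ∞ 0ℓ → Set
v IsMinimumOf P = v ∈ P × (∀ w → w ∈ P → v ≤∞ w)

-- As a minimum over an infinite set, e₃(k,n) is rendered relationally:
-- `e₃[ k , n ]≡ v` asserts that the minimum is attained and equals v.
e₃[_,_]≡_ : (k n : ℕ) → ℕ∞ → Set
e₃[ k , n ]≡ v = v IsMinimumOf (λ w → ∃[ j ] j ≥ n × w ≡ ν₃ (a₃ k j))

-- Used for n ≥ 1 only, where truncated subtraction is subtraction.
s₃ : ℕ → ℕ∞
s₃ n = [ n ∸ 1 ] +∞ ν₃ (+ ((n / 3) !))

-- The digits come least significant first, but the condition is symmetric.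
T : Pred ℕ 0ℓ
T t = Linked (λ d d′ → toℕ d + toℕ d′ < 3) (proj₁ (toDigits 3 t))

T′ : Pred ℕ 0ℓ
T′ = T ∩ λ t → t % 3 ≢ 2

-- a ⟨ A ⟩+ b is the set aA + b.
_⟨_⟩+_ : ℕ → Pred ℕ 0ℓ → ℕ → Pred ℕ 0ℓ
(a ⟨ A ⟩+ b) m = ∃[ t ] t ∈ A × m ≡ a * t + b

{-# OPTIONS --safe #-}
module Submission where

-- Let E be the shift and D = 1 − E, so that ∑ (-1)^i (j choose i) u(i) = (D^j u)(0).  The full sum over i of
-- (-1)^i (j choose i) i^k vanishes for k < j, hence a₃(k,j) = -3^k (D^j u)(0), where u(3x) = x^k and u vanishes
-- off the multiples of 3.  On such functions 1 − E³ acts as D acts on x ↦ x^k, and D³ = (1 − E³) − 3ED; expanding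
-- D^(3J) by the binomial theorem, and using that s! divides D^s x^k, shows that for j = 3J + r (r < 3) the number
-- (D^j u)(0) is ±J! S(k,J) up to terms of larger 3-adic valuation than J!.  So e₃(n-1,n) = s₃(n) iff S(n-1,J) is
-- prime to 3 for some J with [n/3] ≤ J ≤ 3[n/9] + 2.  Modulo 3 these Stirling numbers are binomial coefficients,
-- all of them zero or equal up to a unit to C(4q+s,q) with q = [n/9] and s < 3, and by Lucas this one is prime to 3
-- iff adding q and 3q + s in base 3 produces no carry, i.e. iff 3q + s ∈ T.

open import Defs
open import Data.Bool.Base using (if_then_else_; true; false)
open import Data.Digit using (toDigits; fromDigits)
open import Data.Fin.Base using (Fin; toℕ)
open import Data.Fin.Properties using (toℕ<n)
open import Data.Integer.Base as ℤ using (ℤ; +_; -[1+_]; -1ℤ; 0ℤ; 1ℤ; ∣_∣)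
import Data.Integer.Divisibility.Signed as ℤ∣
open ℤ∣ using () renaming (_∣_ to _∣ℤ_)
import Data.Integer.Properties as ℤₚ
import Data.Integer.Tactic.RingSolver as ℤ-Solver
open import Data.List.Base using (List; []; _∷_; foldr; map; filter; upTo; applyUpTo)
open import Data.List.Relation.Unary.Linked as Linked using (Linked; [-])
open import Data.Nat
open import Data.Nat.Combinatorics
open import Data.Nat.DivMod
open import Data.Nat.Divisibility
open import Data.Nat.Induction using (<-rec)
open import Data.Nat.Primality using (Prime; prime?; euclidsLemma)
open import Data.Nat.Properties
import Data.Nat.Tactic.RingSolver as ℕ-Solver
open import Data.Product.Base using (∃-syntax; _×_; _,_; proj₁; proj₂)
open import Data.Sum.Base using (inj₁; inj₂; [_,_]′)
open import Function.Base using (_∘_; id)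
open import Function.Bundles using (_⇔_; mk⇔; Equivalence)
open import Function.Construct.Composition using (_⇔-∘_)
open import Function.Construct.Symmetry using (⇔-sym)
open import Relation.Binary.Construct.Add.Supremum.NonStrict _≤_ using ([_]; _≤⊤⁺)
open import Relation.Binary.Definitions using (tri<; tri≈; tri>)
open import Relation.Binary.PropositionalEquality hiding (J; [_])
open import Relation.Nullary using (¬_; ¬?; yes; no; does; contradiction)
open import Relation.Nullary.Construct.Add.Supremum using ([_])
open import Relation.Nullary.Decidable using (from-yes; from-no)
open import Relation.Unary using (Pred; Decidable; _∈_; _∪_)
open Equivalence using (to; from)

-- Iterated differences of integer sequences

δ : ℕ → (ℕ → ℤ) → ℕ → ℤ
δ zero    u i = u i
δ (suc j) u i = δ j u i ℤ.- δ j u (suc i)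

δ-cong : ∀ j {u w} → (∀ i → u i ≡ w i) → ∀ i → δ j u i ≡ δ j w i
δ-cong zero    u≗w i = u≗w i
δ-cong (suc j) u≗w i = cong₂ ℤ._-_ (δ-cong j u≗w i) (δ-cong j u≗w (suc i))

δ-sucʳ : ∀ j u i → δ j (δ 1 u) i ≡ δ (suc j) u i
δ-sucʳ zero    u i = refl
δ-sucʳ (suc j) u i = cong₂ ℤ._-_ (δ-sucʳ j u i) (δ-sucʳ j u (suc i))

δ-+ : ∀ j u w i → δ j (λ x → u x ℤ.+ w x) i ≡ δ j u i ℤ.+ δ j w i
δ-+ zero    u w i = refl
δ-+ (suc j) u w i = trans (cong₂ ℤ._-_ (δ-+ j u w i) (δ-+ j u w (suc i)))
  (interchange (δ j u i) (δ j w i) (δ j u (suc i)) (δ j w (suc i)))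
  where
  interchange : ∀ a b c d → (a ℤ.+ b) ℤ.- (c ℤ.+ d) ≡ (a ℤ.- c) ℤ.+ (b ℤ.- d)
  interchange = ℤ-Solver.solve-∀

δ-* : ∀ j c u i → δ j (λ x → c ℤ.* u x) i ≡ c ℤ.* δ j u i
δ-* zero    c u i = refl
δ-* (suc j) c u i = trans (cong₂ ℤ._-_ (δ-* j c u i) (δ-* j c u (suc i)))
  (distrib c (δ j u i) (δ j u (suc i)))
  where
  distrib : ∀ c a b → c ℤ.* a ℤ.- c ℤ.* b ≡ c ℤ.* (a ℤ.- b)
  distrib = ℤ-Solver.solve-∀

-- With `x` for multiplication by the argument, D x = x D - E. Since E commutes with D, moving `x`
-- past `suc s` factors D produces `suc s` copies of E D^s.
δ-leibniz : ∀ s g i → δ (suc s) (λ x → + x ℤ.* g x) i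
                    ≡ + i ℤ.* δ (suc s) g i ℤ.- + suc s ℤ.* δ s g (suc i)
δ-leibniz zero g i rewrite ℤₚ.pos-+ 1 i = lem (+ i) (g i) (g (suc i))
  where
  lem : ∀ i a b → i ℤ.* a ℤ.- (1ℤ ℤ.+ i) ℤ.* b ≡ i ℤ.* (a ℤ.- b) ℤ.- 1ℤ ℤ.* b
  lem = ℤ-Solver.solve-∀
δ-leibniz (suc s) g i = trans
  (cong₂ ℤ._-_ (δ-leibniz s g i) (δ-leibniz s g (suc i)))
  (lem (+ i) (+ suc s) (δ s g i) (δ s g (suc i)) (δ s g (2 + i)))
  where
  lem : ∀ i s a b c →
    (i ℤ.* (a ℤ.- b) ℤ.- s ℤ.* b) ℤ.- ((1ℤ ℤ.+ i) ℤ.* (b ℤ.- c) ℤ.- s ℤ.* c)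
    ≡ i ℤ.* ((a ℤ.- b) ℤ.- (b ℤ.- c)) ℤ.- (1ℤ ℤ.+ s) ℤ.* (b ℤ.- c)
  lem = ℤ-Solver.solve-∀

-- Stirling numbers of the second kind

S : ℕ → ℕ → ℕ
S zero    zero    = 1
S zero    (suc m) = 0
S (suc k) zero    = 0
S (suc k) (suc m) = suc m * S k (suc m) + S k m

k<m⇒S≡0 : ∀ {k m} → k < m → S k m ≡ 0
k<m⇒S≡0 {zero}  {suc m} _         = refl
k<m⇒S≡0 {suc k} {suc m} (s≤s k<m)
  rewrite k<m⇒S≡0 k<m | k<m⇒S≡0 (m<n⇒m<1+n k<m) = trans (+-identityʳ _) (*-zeroʳ m)

pow : ℕ → ℕ → ℤ
pow k i = (+ i) ℤ.^ k

δ-const : ∀ s i → δ (suc s) (pow 0) i ≡ 0ℤ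
δ-const zero    i = refl
δ-const (suc s) i = cong₂ ℤ._-_ (δ-const s i) (δ-const s (suc i))

-- At 0 the Leibniz rule leaves only -(s+1) (D^s x^k)(1). Writing E = 1 - D brings this back to
-- values at 0, which combine by the Stirling recurrence.
δ-pow : ∀ s k → δ s (pow k) 0 ≡ -1ℤ ℤ.^ s ℤ.* + (s ! * S k s)
δ-pow zero    zero    = refl
δ-pow zero    (suc k) = refl
δ-pow (suc s) zero    = trans (δ-const s 0)
  (sym (trans (cong (λ x → -1ℤ ℤ.^ suc s ℤ.* + x) (*-zeroʳ (suc s !))) (ℤₚ.*-zeroʳ (-1ℤ ℤ.^ suc s))))
δ-pow (suc s) (suc k) = begin
  δ (suc s) (λ x → + x ℤ.* pow k x) 0
    ≡⟨ δ-leibniz s (pow k) 0 ⟩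
  0ℤ ℤ.* δ (suc s) (pow k) 0 ℤ.- + suc s ℤ.* δ s (pow k) 1
    ≡⟨ lem₁ (+ suc s) (δ s (pow k) 0) (δ s (pow k) 1) ⟩
  ℤ.- (+ suc s ℤ.* (δ s (pow k) 0 ℤ.- δ (suc s) (pow k) 0))
    ≡⟨ cong₂ (λ x y → ℤ.- (+ suc s ℤ.* (x ℤ.- y)))
         (trans (δ-pow s k) (cong (σ ℤ.*_) (ℤₚ.pos-* (s !) (S k s))))
         (trans (δ-pow (suc s) k) (cong ((-1ℤ ℤ.* σ) ℤ.*_)
           (trans (ℤₚ.pos-* (suc s !) (S k (suc s))) (cong (ℤ._* + S k (suc s)) (ℤₚ.pos-* (suc s) (s !)))))) ⟩
  ℤ.- (+ suc s ℤ.* (σ ℤ.* (+ (s !) ℤ.* + S k s)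
        ℤ.- -1ℤ ℤ.* σ ℤ.* (+ suc s ℤ.* + (s !) ℤ.* + S k (suc s))))
    ≡⟨ lem₂ σ (+ suc s) (+ (s !)) (+ S k s) (+ S k (suc s)) ⟩
  -1ℤ ℤ.* σ ℤ.* (+ suc s ℤ.* + (s !) ℤ.* (+ suc s ℤ.* + S k (suc s) ℤ.+ + S k s))
    ≡⟨ cong ((-1ℤ ℤ.* σ) ℤ.*_) (cong₂ ℤ._*_ (ℤₚ.pos-* (suc s) (s !))
         (trans (ℤₚ.pos-+ (suc s * S k (suc s)) (S k s))
                (cong (ℤ._+ + S k s) (ℤₚ.pos-* (suc s) (S k (suc s)))))) ⟨
  -1ℤ ℤ.* σ ℤ.* (+ (suc s !) ℤ.* + S (suc k) (suc s))
    ≡⟨ cong ((-1ℤ ℤ.* σ) ℤ.*_) (ℤₚ.pos-* (suc s !) (S (suc k) (suc s))) ⟨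
  -1ℤ ℤ.* σ ℤ.* + (suc s ! * S (suc k) (suc s)) ∎
  where
  open ≡-Reasoning
  σ = -1ℤ ℤ.^ s
  lem₁ : ∀ n a b → 0ℤ ℤ.* (a ℤ.- b) ℤ.- n ℤ.* b ≡ ℤ.- (n ℤ.* (a ℤ.- (a ℤ.- b)))
  lem₁ = ℤ-Solver.solve-∀
  lem₂ : ∀ σ n f a b →
    ℤ.- (n ℤ.* (σ ℤ.* (f ℤ.* a) ℤ.- -1ℤ ℤ.* σ ℤ.* (n ℤ.* f ℤ.* b)))
    ≡ -1ℤ ℤ.* σ ℤ.* (n ℤ.* f ℤ.* (n ℤ.* b ℤ.+ a))
  lem₂ = ℤ-Solver.solve-∀

-- At 0 the quotient is a Stirling number up to sign. The step from `i` to `suc i` is E D^s = D^s -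
-- D^(s+1), where s! divides (s+1)!.
s!∣δ-pow : ∀ s k i → + (s !) ∣ℤ δ s (pow k) i
s!∣δ-pow s k zero    = subst (+ (s !) ∣ℤ_) (sym (δ-pow s k))
  (ℤ∣.∣n⇒∣m*n (-1ℤ ℤ.^ s) (ℤ∣.∣ᵤ⇒∣ (m∣m*n (S k s))))
s!∣δ-pow s k (suc i) = subst (+ (s !) ∣ℤ_) (lem (δ s (pow k) i) (δ s (pow k) (suc i)))
  (ℤ∣.∣m∣n⇒∣m-n (s!∣δ-pow s k i)
    (ℤ∣.∣-trans (ℤ∣.∣ᵤ⇒∣ (n∣m*n (suc s))) (s!∣δ-pow (suc s) k i)))
  where
  lem : ∀ a b → a ℤ.- (a ℤ.- b) ≡ b
  lem = ℤ-Solver.solve-∀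

-- Binomial sums

sum : ℕ → (ℕ → ℤ) → ℤ
sum zero    f = 0ℤ
sum (suc n) f = f 0 ℤ.+ sum n (f ∘ suc)

sum-cong : ∀ n {f g} → (∀ i → f i ≡ g i) → sum n f ≡ sum n g
sum-cong zero    f≗g = refl
sum-cong (suc n) f≗g = cong₂ ℤ._+_ (f≗g 0) (sum-cong n (f≗g ∘ suc))

sum-+ : ∀ n f g → sum n (λ i → f i ℤ.+ g i) ≡ sum n f ℤ.+ sum n g
sum-+ zero    f g = refl
sum-+ (suc n) f g = trans (cong (λ x → f 0 ℤ.+ g 0 ℤ.+ x) (sum-+ n (f ∘ suc) (g ∘ suc)))
  (interchange (f 0) (g 0) (sum n (f ∘ suc)) (sum n (g ∘ suc)))
  where
  interchange : ∀ a b c d → a ℤ.+ b ℤ.+ (c ℤ.+ d) ≡ a ℤ.+ c ℤ.+ (b ℤ.+ d)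
  interchange = ℤ-Solver.solve-∀

sum-0 : ∀ n {f} → (∀ i → f i ≡ 0ℤ) → sum n f ≡ 0ℤ
sum-0 zero    f≗0 = refl
sum-0 (suc n) f≗0 = cong₂ ℤ._+_ (f≗0 0) (sum-0 n (f≗0 ∘ suc))

∣-sum : ∀ {m} n {f} → (∀ i → m ∣ℤ f i) → m ∣ℤ sum n f
∣-sum zero    m∣f = ℤ∣.divides 0ℤ refl
∣-sum (suc n) m∣f = ℤ∣.∣m∣n⇒∣m+n (m∣f 0) (∣-sum n (m∣f ∘ suc))

nC0≡1 : ∀ n → n C 0 ≡ 1
nC0≡1 n = trans (nCk≡nC[n∸k] {0} {n} z≤n) (nCn≡1 n)

-- This is ∑ (j choose i) φ(i), built by Pascal's rule instead of from its coefficients, so that it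
-- unfolds in step with `δ` and with the expansion of D^(3J).
binomialSum : ℕ → (ℕ → ℤ) → ℤ
binomialSum zero    φ = φ 0
binomialSum (suc j) φ = binomialSum j φ ℤ.+ binomialSum j (φ ∘ suc)

binomialSum-cong : ∀ j {φ ψ} → (∀ {i} → i ≤ j → φ i ≡ ψ i) → binomialSum j φ ≡ binomialSum j ψ
binomialSum-cong zero    φ≗ψ = φ≗ψ z≤n
binomialSum-cong (suc j) φ≗ψ =
  cong₂ ℤ._+_ (binomialSum-cong j (φ≗ψ ∘ m≤n⇒m≤1+n)) (binomialSum-cong j (φ≗ψ ∘ s≤s))

binomialSum-* : ∀ j c φ → binomialSum j (λ i → c ℤ.* φ i) ≡ c ℤ.* binomialSum j φ
binomialSum-* zero    c φ = refl
binomialSum-* (suc j) c φ = trans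
  (cong₂ ℤ._+_ (binomialSum-* j c φ) (binomialSum-* j c (φ ∘ suc)))
  (sym (ℤₚ.*-distribˡ-+ c (binomialSum j φ) (binomialSum j (φ ∘ suc))))

-- Any upper limit beyond `j` is allowed, as the extra coefficients vanish. This slack lets both
-- recursive sums be taken up to the same `n`.
binomialSum≡sum : ∀ {j n} φ → j < n → binomialSum j φ ≡ sum n (λ i → + (j C i) ℤ.* φ i)
binomialSum≡sum {zero} {suc n} φ _ = sym (trans
  (cong₂ ℤ._+_ (ℤₚ.*-identityˡ (φ 0)) (sum-0 n (λ i → ℤₚ.*-zeroˡ (φ (suc i)))))
  (ℤₚ.+-identityʳ (φ 0)))
binomialSum≡sum {suc j} {suc n} φ (s≤s j<n) = begin
  binomialSum j φ ℤ.+ binomialSum j (φ ∘ suc)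
    ≡⟨ cong₂ ℤ._+_ (binomialSum≡sum φ (m<n⇒m<1+n j<n)) (binomialSum≡sum (φ ∘ suc) j<n) ⟩
  + (j C 0) ℤ.* φ 0 ℤ.+ sum n (λ i → + (j C suc i) ℤ.* φ (suc i)) ℤ.+ sum n (λ i → + (j C i) ℤ.* φ (suc i))
    ≡⟨ ℤₚ.+-assoc (+ (j C 0) ℤ.* φ 0) _ _ ⟩
  + (j C 0) ℤ.* φ 0 ℤ.+ (sum n (λ i → + (j C suc i) ℤ.* φ (suc i)) ℤ.+ sum n (λ i → + (j C i) ℤ.* φ (suc i)))
    ≡⟨ cong₂ ℤ._+_ (cong (λ x → + x ℤ.* φ 0) (trans (nC0≡1 j) (sym (nC0≡1 (suc j)))))
         (trans (sym (sum-+ n _ _)) (sum-cong n pascal)) ⟩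
  + (suc j C 0) ℤ.* φ 0 ℤ.+ sum n (λ i → + (suc j C suc i) ℤ.* φ (suc i)) ∎
  where
  open ≡-Reasoning
  pascal : ∀ i → + (j C suc i) ℤ.* φ (suc i) ℤ.+ + (j C i) ℤ.* φ (suc i) ≡ + (suc j C suc i) ℤ.* φ (suc i)
  pascal i = trans (sym (ℤₚ.*-distribʳ-+ (φ (suc i)) (+ (j C suc i)) (+ (j C i))))
    (cong (λ x → + x ℤ.* φ (suc i)) (trans (+-comm (j C suc i) (j C i)) (nCk+nC[k+1]≡[n+1]C[k+1] j i)))

δ≡binomialSum : ∀ j u i → δ j u i ≡ binomialSum j (λ t → -1ℤ ℤ.^ t ℤ.* u (i + t))
δ≡binomialSum zero    u i = sym (trans (ℤₚ.*-identityˡ _) (cong u (+-identityʳ i)))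
δ≡binomialSum (suc j) u i = cong₂ ℤ._+_ (δ≡binomialSum j u i) (begin
  ℤ.- δ j u (suc i)
    ≡⟨ cong ℤ.-_ (δ≡binomialSum j u (suc i)) ⟩
  ℤ.- binomialSum j (λ t → -1ℤ ℤ.^ t ℤ.* u (suc i + t))
    ≡⟨ ℤₚ.-1*i≡-i _ ⟨
  -1ℤ ℤ.* binomialSum j (λ t → -1ℤ ℤ.^ t ℤ.* u (suc i + t))
    ≡⟨ binomialSum-* j -1ℤ _ ⟨
  binomialSum j (λ t → -1ℤ ℤ.* (-1ℤ ℤ.^ t ℤ.* u (suc i + t)))
    ≡⟨ binomialSum-cong j (λ {t} _ → trans (sym (ℤₚ.*-assoc -1ℤ (-1ℤ ℤ.^ t) _))
         (cong (λ x → -1ℤ ℤ.^ suc t ℤ.* u x) (sym (+-suc i t)))) ⟩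
  binomialSum j (λ t → -1ℤ ℤ.^ suc t ℤ.* u (i + suc t)) ∎)
  where open ≡-Reasoning

-- Functions supported on the multiples of 3

-- Recursion in steps of three makes the shift E³ of `spread f` equal to `spread (f ∘ suc)` by
-- definition.
spread : (ℕ → ℤ) → ℕ → ℤ
spread f 0                   = f 0
spread f 1                   = 0ℤ
spread f 2                   = 0ℤ
spread f (suc (suc (suc i))) = spread (f ∘ suc) i

spread-cong : ∀ {f g} → (∀ i → f i ≡ g i) → ∀ i → spread f i ≡ spread g i
spread-cong f≗g 0 = f≗g 0
spread-cong f≗g 1 = refl
spread-cong f≗g 2 = refl
spread-cong f≗g (suc (suc (suc i))) = spread-cong (f≗g ∘ suc) i

spread-* : ∀ c f i → spread (λ x → c ℤ.* f x) i ≡ c ℤ.* spread f i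
spread-* c f 0 = refl
spread-* c f 1 = sym (ℤₚ.*-zeroʳ c)
spread-* c f 2 = sym (ℤₚ.*-zeroʳ c)
spread-* c f (suc (suc (suc i))) = spread-* c (f ∘ suc) i

spread-δ : ∀ f i → spread f i ℤ.- spread f (3 + i) ≡ spread (δ 1 f) i
spread-δ f 0 = refl
spread-δ f 1 = refl
spread-δ f 2 = refl
spread-δ f (suc (suc (suc i))) = spread-δ (f ∘ suc) i

∣-spread : ∀ {m f} → (∀ i → m ∣ℤ f i) → ∀ i → m ∣ℤ spread f i
∣-spread m∣f 0 = m∣f 0
∣-spread m∣f 1 = ℤ∣.divides 0ℤ refl
∣-spread m∣f 2 = ℤ∣.divides 0ℤ refl
∣-spread m∣f (suc (suc (suc i))) = ∣-spread (m∣f ∘ suc) i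

∣-δ : ∀ {m} j {u} → (∀ i → m ∣ℤ u i) → ∀ i → m ∣ℤ δ j u i
∣-δ zero    m∣u i = m∣u i
∣-δ (suc j) m∣u i = ℤ∣.∣m∣n⇒∣m-n (∣-δ j m∣u i) (∣-δ j m∣u (suc i))

δ-spread-δ : ∀ j f i → δ j (spread f) i ℤ.- δ j (spread f) (3 + i) ≡ δ j (spread (δ 1 f)) i
δ-spread-δ zero    f i = spread-δ f i
δ-spread-δ (suc j) f i = trans
  (interchange (δ j (spread f) i) (δ j (spread f) (1 + i)) (δ j (spread f) (3 + i)) (δ j (spread f) (4 + i)))
  (cong₂ ℤ._-_ (δ-spread-δ j f i) (δ-spread-δ j f (suc i)))
  where
  interchange : ∀ a b c d → (a ℤ.- b) ℤ.- (c ℤ.- d) ≡ (a ℤ.- c) ℤ.- (b ℤ.- d)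
  interchange = ℤ-Solver.solve-∀

-3ℤ : ℤ
-3ℤ = -[1+ 2 ]

-- In terms of the shift E and D = 1 − E, D³ = (1 − E³) − 3ED.
δ-spread-step : ∀ j f i → δ (3 + j) (spread f) i
                        ≡ δ j (spread (δ 1 f)) i ℤ.+ -3ℤ ℤ.* δ (suc j) (spread f) (suc i)
δ-spread-step j f i = trans
  (lem (δ j (spread f) i) (δ j (spread f) (1 + i)) (δ j (spread f) (2 + i)) (δ j (spread f) (3 + i)))
  (cong (ℤ._+ -3ℤ ℤ.* δ (suc j) (spread f) (suc i)) (δ-spread-δ j f i))
  where
  lem : ∀ a b c d → ((a ℤ.- b) ℤ.- (b ℤ.- c)) ℤ.- ((b ℤ.- c) ℤ.- (c ℤ.- d))
                  ≡ (a ℤ.- d) ℤ.+ -3ℤ ℤ.* (b ℤ.- c)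
  lem = ℤ-Solver.solve-∀

-- The term (-3)^t E^t D^(t+r) (1 - E³)^(J-t) of ((1 - E³) - 3ED)^J D^r, without its binomial
-- coefficient. The power of 1 - E³ is carried inside `spread` as a power of D.
spreadTerm : ℕ → ℕ → (ℕ → ℤ) → ℕ → ℕ → ℤ
spreadTerm J r f i t = -3ℤ ℤ.^ t ℤ.* δ (t + r) (spread (δ (J ∸ t) f)) (t + i)

-- Each use of D³ = (1 - E³) - 3ED either replaces `f` by `δ 1 f` or raises both `r` and `i`, so the
-- induction on `J` needs all three to vary.
δ-spread-expansion : ∀ J r f i → δ (J * 3 + r) (spread f) i ≡ binomialSum J (spreadTerm J r f i)
δ-spread-expansion zero    r f i = sym (ℤₚ.*-identityˡ _)
δ-spread-expansion (suc J) r f i = begin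
  δ (3 + (J * 3 + r)) (spread f) i
    ≡⟨ δ-spread-step (J * 3 + r) f i ⟩
  δ (J * 3 + r) (spread (δ 1 f)) i ℤ.+ -3ℤ ℤ.* δ (suc (J * 3 + r)) (spread f) (suc i)
    ≡⟨ cong₂ (λ x y → x ℤ.+ -3ℤ ℤ.* y) (δ-spread-expansion J r (δ 1 f) i)
         (trans (cong (λ n → δ n (spread f) (suc i)) (sym (+-suc (J * 3) r)))
                (δ-spread-expansion J (suc r) f (suc i))) ⟩
  binomialSum J (spreadTerm J r (δ 1 f) i) ℤ.+ -3ℤ ℤ.* binomialSum J (spreadTerm J (suc r) f (suc i))
    ≡⟨ cong₂ ℤ._+_ (binomialSum-cong J stepˡ)
         (trans (sym (binomialSum-* J -3ℤ _)) (binomialSum-cong J (λ {t} _ → stepʳ t))) ⟩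
  binomialSum J (spreadTerm (suc J) r f i) ℤ.+ binomialSum J (spreadTerm (suc J) r f i ∘ suc) ∎
  where
  open ≡-Reasoning
  stepˡ : ∀ {t} → t ≤ J → spreadTerm J r (δ 1 f) i t ≡ spreadTerm (suc J) r f i t
  stepˡ {t} t≤J = cong (-3ℤ ℤ.^ t ℤ.*_) (δ-cong (t + r) (spread-cong λ x →
    trans (δ-sucʳ (J ∸ t) f x) (cong (λ n → δ n f x) (sym (+-∸-assoc 1 t≤J)))) (t + i))
  stepʳ : ∀ t → -3ℤ ℤ.* spreadTerm J (suc r) f (suc i) t ≡ spreadTerm (suc J) r f i (suc t)
  stepʳ t = trans (sym (ℤₚ.*-assoc -3ℤ (-3ℤ ℤ.^ t) _)) (cong₂ (λ m n → -3ℤ ℤ.^ suc t ℤ.* δ m (spread (δ (J ∸ t) f)) n)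
    (+-suc t r) (+-suc t i))

-- The partial Stirling number as an iterated difference

foldr-filter : ∀ {p} {P : Pred ℕ p} (P? : Decidable P) (t : ℕ → ℤ) xs →
  foldr ℤ._+_ 0ℤ (map t (filter P? xs))
  ≡ foldr ℤ._+_ 0ℤ (map (λ i → if does (P? i) then t i else 0ℤ) xs)
foldr-filter P? t []       = refl
foldr-filter P? t (x ∷ xs) with does (P? x)
... | true  = cong (λ y → t x ℤ.+ y) (foldr-filter P? t xs)
... | false = trans (foldr-filter P? t xs) (sym (ℤₚ.+-identityˡ _))

foldr-applyUpTo : ∀ (g : ℕ → ℤ) h n → foldr ℤ._+_ 0ℤ (map g (applyUpTo h n)) ≡ sum n (g ∘ h)
foldr-applyUpTo g h zero    = refl
foldr-applyUpTo g h (suc n) = cong (λ y → g (h 0) ℤ.+ y) (foldr-applyUpTo g (h ∘ suc) n)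

foldr-filter-upTo : ∀ {p} {P : Pred ℕ p} (P? : Decidable P) (t : ℕ → ℤ) n →
  foldr ℤ._+_ 0ℤ (map t (filter P? (upTo n))) ≡ sum n (λ i → if does (P? i) then t i else 0ℤ)
foldr-filter-upTo P? t n = trans (foldr-filter P? t (upTo n)) (foldr-applyUpTo _ id n)

offMultiples : (ℕ → ℤ) → ℕ → ℤ
offMultiples f i = if does (¬? (i % 3 ≟ 0)) then f i else 0ℤ

a₃≡δ : ∀ k j → a₃ k j ≡ δ j (offMultiples (pow k)) 0
a₃≡δ k j = begin
  a₃ k j
    ≡⟨ foldr-filter-upTo (λ i → ¬? (i % 3 ≟ 0)) _ (suc j) ⟩
  sum (suc j) (λ i → if does (¬? (i % 3 ≟ 0)) then -1ℤ ℤ.^ i ℤ.* + (j C i) ℤ.* (+ i) ℤ.^ k else 0ℤ)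
    ≡⟨ sum-cong (suc j) reorder ⟩
  sum (suc j) (λ i → + (j C i) ℤ.* (-1ℤ ℤ.^ i ℤ.* offMultiples (pow k) i))
    ≡⟨ binomialSum≡sum (λ i → -1ℤ ℤ.^ i ℤ.* offMultiples (pow k) i) (n<1+n j) ⟨
  binomialSum j (λ i → -1ℤ ℤ.^ i ℤ.* offMultiples (pow k) i)
    ≡⟨ δ≡binomialSum j (offMultiples (pow k)) 0 ⟨
  δ j (offMultiples (pow k)) 0 ∎
  where
  open ≡-Reasoning
  lem : ∀ a b c → a ℤ.* b ℤ.* c ≡ b ℤ.* (a ℤ.* c)
  lem = ℤ-Solver.solve-∀
  lem₀ : ∀ a b → 0ℤ ≡ b ℤ.* (a ℤ.* 0ℤ)
  lem₀ = ℤ-Solver.solve-∀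
  reorder : ∀ i → (if does (¬? (i % 3 ≟ 0)) then -1ℤ ℤ.^ i ℤ.* + (j C i) ℤ.* (+ i) ℤ.^ k else 0ℤ)
                ≡ + (j C i) ℤ.* (-1ℤ ℤ.^ i ℤ.* offMultiples (pow k) i)
  reorder i with does (¬? (i % 3 ≟ 0))
  ... | true  = lem (-1ℤ ℤ.^ i) (+ (j C i)) ((+ i) ℤ.^ k)
  ... | false = lem₀ (-1ℤ ℤ.^ i) (+ (j C i))

offMultiples+spread : ∀ f i → offMultiples f i ℤ.+ spread (λ x → f (x * 3)) i ≡ f i
offMultiples+spread f 0 = ℤₚ.+-identityˡ (f 0)
offMultiples+spread f 1 = ℤₚ.+-identityʳ (f 1)
offMultiples+spread f 2 = ℤₚ.+-identityʳ (f 2)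
offMultiples+spread f (suc (suc (suc i))) = offMultiples+spread (λ x → f (3 + x)) i

pow-*3 : ∀ k x → pow k (x * 3) ≡ + (3 ^ k) ℤ.* pow k x
pow-*3 zero    x = refl
pow-*3 (suc k) x = begin
  + (x * 3) ℤ.* pow k (x * 3)
    ≡⟨ cong₂ ℤ._*_ (ℤₚ.pos-* x 3) (pow-*3 k x) ⟩
  + x ℤ.* + 3 ℤ.* (+ (3 ^ k) ℤ.* pow k x)
    ≡⟨ lem (+ x) (+ 3) (+ (3 ^ k)) (pow k x) ⟩
  + 3 ℤ.* + (3 ^ k) ℤ.* (+ x ℤ.* pow k x)
    ≡⟨ cong (ℤ._* (+ x ℤ.* pow k x)) (ℤₚ.pos-* 3 (3 ^ k)) ⟨
  + (3 ^ suc k) ℤ.* (+ x ℤ.* pow k x) ∎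
  where
  open ≡-Reasoning
  lem : ∀ a b c d → a ℤ.* b ℤ.* (c ℤ.* d) ≡ b ℤ.* c ℤ.* (a ℤ.* d)
  lem = ℤ-Solver.solve-∀

-- The full alternating sum ∑ (-1)^i (j choose i) i^k vanishes for k < j.
a₃-multiples : ∀ {k j} → k < j → a₃ k j ≡ ℤ.- (+ (3 ^ k) ℤ.* δ j (spread (pow k)) 0)
a₃-multiples {k} {j} k<j = trans (a₃≡δ k j) (lem _ _ (begin
  δ j (offMultiples (pow k)) 0 ℤ.+ + (3 ^ k) ℤ.* δ j (spread (pow k)) 0
    ≡⟨ cong (λ x → δ j (offMultiples (pow k)) 0 ℤ.+ x) (trans (sym (δ-* j (+ (3 ^ k)) (spread (pow k)) 0)) (δ-cong j (λ i → sym
         (trans (spread-cong (pow-*3 k) i) (spread-* (+ (3 ^ k)) (pow k) i))) 0)) ⟩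
  δ j (offMultiples (pow k)) 0 ℤ.+ δ j (spread (λ x → pow k (x * 3))) 0
    ≡⟨ δ-+ j (offMultiples (pow k)) (spread (λ x → pow k (x * 3))) 0 ⟨
  δ j (λ i → offMultiples (pow k) i ℤ.+ spread (λ x → pow k (x * 3)) i) 0
    ≡⟨ δ-cong j (offMultiples+spread (pow k)) 0 ⟩
  δ j (pow k) 0
    ≡⟨ δ-pow j k ⟩
  -1ℤ ℤ.^ j ℤ.* + (j ! * S k j)
    ≡⟨ cong (λ x → -1ℤ ℤ.^ j ℤ.* + x) (trans (cong (j ! *_) (k<m⇒S≡0 k<j)) (*-zeroʳ (j !))) ⟩
  -1ℤ ℤ.^ j ℤ.* 0ℤ
    ≡⟨ ℤₚ.*-zeroʳ (-1ℤ ℤ.^ j) ⟩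
  0ℤ ∎))
  where
  open ≡-Reasoning
  rearrange : ∀ a b → a ≡ (a ℤ.+ b) ℤ.- b
  rearrange = ℤ-Solver.solve-∀
  lem : ∀ a b → a ℤ.+ b ≡ 0ℤ → a ≡ ℤ.- b
  lem a b a+b≡0 = trans (rearrange a b) (trans (cong (ℤ._- b) a+b≡0) (ℤₚ.+-identityˡ (ℤ.- b)))

-- 3-adic valuations of factorials

prime-3 : Prime 3
prime-3 = from-yes (prime? 3)

3∤* : ∀ {m n} → 3 ∤ m → 3 ∤ n → 3 ∤ m * n
3∤* {m} {n} 3∤m 3∤n 3∣mn = [ 3∤m , 3∤n ]′ (euclidsLemma m n prime-3 3∣mn)

3∤s+q*3 : ∀ {s} q → 3 ∤ s → 3 ∤ s + q * 3
3∤s+q*3 {s} q 3∤s 3∣s+q*3 = 3∤s (∣m+n∣m⇒∣n (subst (3 ∣_) (+-comm s (q * 3)) 3∣s+q*3) (n∣m*n q))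

3∤1 : 3 ∤ 1
3∤1 = from-no (3 ∣? 1)

3∤2 : 3 ∤ 2
3∤2 = from-no (3 ∣? 2)

3^∣-cancelʳ : ∀ v {u x} → 3 ∤ u → 3 ^ v ∣ x * u → 3 ^ v ∣ x
3^∣-cancelʳ zero    {x = x} 3∤u _ = 1∣ x
3^∣-cancelʳ (suc v) {u} {x} 3∤u 3^∣xu
  with euclidsLemma x u prime-3 (∣-trans (m∣m*n (3 ^ v)) 3^∣xu)
... | inj₂ 3∣u              = contradiction 3∣u 3∤u
... | inj₁ (divides y refl) = subst (3 ^ suc v ∣_) (*-comm 3 y)
  (*-monoʳ-∣ 3 (3^∣-cancelʳ v {u} {y} 3∤u (*-cancelˡ-∣ {3 ^ v} {y * u} 3 (subst (3 ^ suc v ∣_) (lem y u) 3^∣xu))))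
  where
  lem : ∀ y u → y * 3 * u ≡ 3 * (y * u)
  lem = ℕ-Solver.solve-∀

-- The multiples of 3 among the factors of (3q)! contribute 3^q q!; the others make up `u`.
[q*3]!-split : ∀ q → ∃[ u ] 3 ∤ u × (q * 3) ! ≡ 3 ^ q * q ! * u
[q*3]!-split zero    = 1 , 3∤1 , refl
[q*3]!-split (suc q) with [q*3]!-split q
... | u , 3∤u , eq = (2 + q * 3) * ((1 + q * 3) * u) , 3∤* (3∤s+q*3 q 3∤2) (3∤* (3∤s+q*3 q 3∤1) 3∤u) ,
  trans (cong (λ x → (3 + q * 3) * ((2 + q * 3) * ((1 + q * 3) * x))) eq) (lem q (3 ^ q) (q !) u)
  where
  lem : ∀ q p f u → (3 + q * 3) * ((2 + q * 3) * ((1 + q * 3) * (p * f * u)))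
                  ≡ 3 * p * ((1 + q) * f) * ((2 + q * 3) * ((1 + q * 3) * u))
  lem = ℕ-Solver.solve-∀

!-split : ∀ q {s} → s < 3 → ∃[ u ] 3 ∤ u × (s + q * 3) ! ≡ 3 ^ q * q ! * u
!-split q {0} _ = [q*3]!-split q
!-split q {1} _ with [q*3]!-split q
... | u , 3∤u , eq = (1 + q * 3) * u , 3∤* (3∤s+q*3 q 3∤1) 3∤u ,
  trans (cong ((1 + q * 3) *_) eq) (lem (1 + q * 3) (3 ^ q * q !) u)
  where
  lem : ∀ a b u → a * (b * u) ≡ b * (a * u)
  lem = ℕ-Solver.solve-∀
!-split q {2} _ with [q*3]!-split q
... | u , 3∤u , eq = (2 + q * 3) * ((1 + q * 3) * u) , 3∤* (3∤s+q*3 q 3∤2) (3∤* (3∤s+q*3 q 3∤1) 3∤u) ,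
  trans (cong (λ x → (2 + q * 3) * ((1 + q * 3) * x)) eq) (lem (2 + q * 3) (1 + q * 3) (3 ^ q * q !) u)
  where
  lem : ∀ a b c u → a * (b * (c * u)) ≡ c * (a * (b * u))
  lem = ℕ-Solver.solve-∀
!-split q {suc (suc (suc _))} (s≤s (s≤s (s≤s ())))

-- For t ≥ 1 the exponent of 3 in t! is less than t.
t!-to-3^t : ∀ t → 1 ≤ t → ∀ x v → 3 ^ v ∣ x * t ! → 3 ^ suc v ∣ x * 3 ^ t
t!-to-3^t = <-rec _ step
  where
  step : ∀ t → (∀ {q} → q < t → 1 ≤ q → ∀ x v → 3 ^ v ∣ x * q ! → 3 ^ suc v ∣ x * 3 ^ q) →
         1 ≤ t → ∀ x v → 3 ^ v ∣ x * t ! → 3 ^ suc v ∣ x * 3 ^ t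
  step t@(suc t-1) rec _ x v 3^v∣x*t! with t / 3 in t/3≡q | m≡m%n+[m/n]*n t 3 | !-split (t / 3) (m%n<n t 3)
  ... | zero | t≡ | u , 3∤u , eq =
    -- Here t < 3, so t! is prime to 3 and the extra factor 3 comes from 3^t, as t ≥ 1.
    subst (3 ^ suc v ∣_) (lem x (3 ^ t-1))
      (*-monoʳ-∣ 3 (∣m⇒∣m*n (3 ^ t-1) (3^∣-cancelʳ v {u} {x} 3∤u (subst (λ y → 3 ^ v ∣ x * y) t!≡u 3^v∣x*t!))))
    where
    lem : ∀ x p → 3 * (x * p) ≡ x * (3 * p)
    lem = ℕ-Solver.solve-∀
    t!≡u : t ! ≡ u
    t!≡u = trans (cong _! t≡) (trans eq (+-identityʳ u))
  ... | q@(suc q-1) | t≡ | u , 3∤u , eq =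
    -- Up to a factor prime to 3, t! is 3^q q!. The 3^q is absorbed into `x`, the induction
    -- hypothesis trades q! for 3^q with a gain of one power of 3, and 3^q 3^q divides 3^t because
    -- 2q ≤ t.
    ∣-trans (rec q<t (s≤s z≤n) (x * 3 ^ q) v (3^∣-cancelʳ v {u} 3∤u
              (subst (3 ^ v ∣_) (trans (cong (x *_) (trans (cong _! t≡) eq)) (lem x (3 ^ q) (q !) u)) 3^v∣x*t!)))
      (divides (3 ^ (t ∸ (q + q))) (begin
        x * 3 ^ t
          ≡⟨ cong (λ n → x * 3 ^ n) (m∸n+n≡m 2q≤t) ⟨
        x * 3 ^ (t ∸ (q + q) + (q + q))
          ≡⟨ cong (x *_) (trans (^-distribˡ-+-* 3 (t ∸ (q + q)) (q + q))
               (cong (3 ^ (t ∸ (q + q)) *_) (^-distribˡ-+-* 3 q q))) ⟩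
        x * (3 ^ (t ∸ (q + q)) * (3 ^ q * 3 ^ q))
          ≡⟨ lem′ x (3 ^ (t ∸ (q + q))) (3 ^ q) ⟩
        3 ^ (t ∸ (q + q)) * (x * 3 ^ q * 3 ^ q) ∎))
    where
    open ≡-Reasoning
    lem : ∀ x p f u → x * (p * f * u) ≡ x * p * f * u
    lem = ℕ-Solver.solve-∀
    lem′ : ∀ x a p → x * (a * (p * p)) ≡ a * (x * p * p)
    lem′ = ℕ-Solver.solve-∀
    q*3≡ : q * 3 ≡ q + q + q
    q*3≡ = trans (*-comm q 3) (trans (cong (λ y → q + (q + y)) (+-identityʳ q)) (sym (+-assoc q q q)))
    2q≤t : q + q ≤ t
    2q≤t = ≤-trans (m≤m+n (q + q) q) (subst (_≤ t) q*3≡ (subst (q * 3 ≤_) (sym t≡) (m≤n+m (q * 3) (t % 3))))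
    q<t : q < t
    q<t = ≤-trans (m<m+n q (s≤s z≤n)) 2q≤t

-- In J! = (J choose t) (J-t)! t! with t ≥ 1, replacing t! by 3^t gains at least one power of 3.
spread-term-divisible : ∀ {J t} v → 3 ^ v ∣ J ! → suc t ≤ J →
  3 ^ suc v ∣ (J C suc t) * (3 ^ suc t * (J ∸ suc t) !)
spread-term-divisible {J} {t-1} v 3^v∣J! t≤J =
  subst (3 ^ suc v ∣_) (lem (J C t) ((J ∸ t) !) (3 ^ t))
    (t!-to-3^t t (s≤s z≤n) ((J C t) * (J ∸ t) !) v (subst (3 ^ v ∣_) J!≡ 3^v∣J!))
  where
  t = suc t-1
  lem : ∀ a b c → a * b * c ≡ a * (c * b)
  lem = ℕ-Solver.solve-∀
  lem′ : ∀ a b c → a * (b * c) ≡ a * c * b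
  lem′ = ℕ-Solver.solve-∀
  instance
    _ = t !* (J ∸ t) !≢0
  J!≡ : J ! ≡ (J C t) * (J ∸ t) ! * t !
  J!≡ = trans (sym (trans (cong (_* (t ! * (J ∸ t) !)) (nCk≡n!/k![n-k]! t≤J)) (m/n*n≡m (k![n∸k]!∣n! t≤J))))
              (lem′ (J C t) (t !) ((J ∸ t) !))

-- The leading term of a difference of a spread function

∣-* : ∀ {a b x y} → a ∣ℤ x → b ∣ℤ y → a ℤ.* b ∣ℤ x ℤ.* y
∣-* {a} {b} {x} {y} a∣x b∣y = ℤ∣.∣-trans (ℤ∣.*-monoˡ-∣ b a∣x) (ℤ∣.*-monoʳ-∣ x b∣y)

3^t∣-3^t : ∀ t → + (3 ^ t) ∣ℤ -3ℤ ℤ.^ t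
3^t∣-3^t zero    = ℤ∣.∣-refl
3^t∣-3^t (suc t) = subst (_∣ℤ -3ℤ ℤ.^ suc t) (sym (ℤₚ.pos-* 3 (3 ^ t)))
  (∣-* {+ 3} {+ (3 ^ t)} { -3ℤ} (ℤ∣.divides -1ℤ refl) (3^t∣-3^t t))

-- The difference involves the arguments 0, ..., r only, and among these 0 is the single multiple of
-- 3.
δ-spread-low : ∀ {r} → r < 3 → ∀ f → δ r (spread f) 0 ≡ f 0
δ-spread-low {0} _ f = refl
δ-spread-low {1} _ f = ℤₚ.+-identityʳ (f 0)
δ-spread-low {2} _ f = trans (ℤₚ.+-identityʳ _) (ℤₚ.+-identityʳ (f 0))
δ-spread-low {suc (suc (suc _))} (s≤s (s≤s (s≤s ())))

-- The term t = 0 of the expansion is (D^J f)(0). For t ≥ 1 the term is divisible by (J choose t)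
-- 3^t (J-t)!, hence by `3 ^ suc v`.
δ-spread-mod : ∀ J {r} → r < 3 → ∀ {f} → (∀ s i → + (s !) ∣ℤ δ s f i) → ∀ v → 3 ^ v ∣ J ! →
  + (3 ^ suc v) ∣ℤ δ (J * 3 + r) (spread f) 0 ℤ.- δ J f 0
δ-spread-mod J {r} r<3 {f} s!∣δ v 3^v∣J! = subst (+ (3 ^ suc v) ∣ℤ_) (sym (begin
  δ (J * 3 + r) (spread f) 0 ℤ.- δ J f 0
    ≡⟨ cong (ℤ._- δ J f 0) (trans (δ-spread-expansion J r f 0) (binomialSum≡sum φ (n<1+n J))) ⟩
  + (J C 0) ℤ.* (1ℤ ℤ.* δ r (spread (δ J f)) 0) ℤ.+ rest ℤ.- δ J f 0
    ≡⟨ cong₂ (λ x y → + x ℤ.* (1ℤ ℤ.* y) ℤ.+ rest ℤ.- δ J f 0) (nC0≡1 J) (δ-spread-low r<3 (δ J f)) ⟩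
  1ℤ ℤ.* (1ℤ ℤ.* δ J f 0) ℤ.+ rest ℤ.- δ J f 0
    ≡⟨ lem (δ J f 0) rest ⟩
  rest ∎)) (∣-sum J term-divisible)
  where
  open ≡-Reasoning
  φ = spreadTerm J r f 0
  rest = sum J (λ t → + (J C suc t) ℤ.* φ (suc t))
  lem : ∀ a b → 1ℤ ℤ.* (1ℤ ℤ.* a) ℤ.+ b ℤ.- a ≡ b
  lem = ℤ-Solver.solve-∀
  term-divisible : ∀ t → + (3 ^ suc v) ∣ℤ + (J C suc t) ℤ.* φ (suc t)
  term-divisible t with suc t ≤? J
  -- `∣-sum` asks for divisibility at every index; past `J` the binomial coefficient is zero.
  ... | no  t≰J = subst (λ x → + (3 ^ suc v) ∣ℤ + x ℤ.* φ (suc t)) (sym (k>n⇒nCk≡0 (≰⇒> t≰J)))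
                    (ℤ∣.divides 0ℤ refl)
  ... | yes t≤J = ℤ∣.∣-trans (ℤ∣.∣ᵤ⇒∣ (spread-term-divisible v 3^v∣J! t≤J))
    (subst (_∣ℤ + (J C suc t) ℤ.* φ (suc t))
      (sym (trans (ℤₚ.pos-* (J C suc t) (3 ^ suc t * (J ∸ suc t) !))
                  (cong (+ (J C suc t) ℤ.*_) (ℤₚ.pos-* (3 ^ suc t) ((J ∸ suc t) !)))))
      (ℤ∣.*-monoʳ-∣ (+ (J C suc t)) (∣-* (3^t∣-3^t (suc t))
        (∣-δ (suc t + r) (∣-spread (s!∣δ (J ∸ suc t))) (suc t + 0)))))

-- Reading `ν₃` off divisibility by powers of 3

3^-mono-∣ : ∀ {a b} → a ≤ b → 3 ^ a ∣ 3 ^ b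
3^-mono-∣ {a} {b} a≤b = divides (3 ^ (b ∸ a)) (trans (cong (3 ^_) (sym (m∸n+n≡m a≤b))) (^-distribˡ-+-* 3 (b ∸ a) a))

exponent₃-NonZero : ∀ m → .{{NonZero m}} → ν₃ (+ m) ≡ [ exponent₃ m m ]
exponent₃-NonZero (suc m) = refl

ν₃-≤ : ∀ {v} z → 3 ^ v ∣ ∣ z ∣ → [ v ] ≤∞ ν₃ z
ν₃-≤ {v} z 3^v∣z with ∣ z ∣
... | zero      = [ v ] ≤⊤⁺
... | m@(suc _) = [ ≮⇒≥ (λ e<v →
  3^[1+exponent₃]∤m m m ≤-refl (∣-trans (3^-mono-∣ e<v) 3^v∣z)) ]

ν₃-≡⁻ : ∀ {v} z → [ v ] ≡ ν₃ z → 3 ^ suc v ∤ ∣ z ∣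
ν₃-≡⁻ z eq 3^∣z with ∣ z ∣
ν₃-≡⁻ z ()   _    | zero
ν₃-≡⁻ z refl 3^∣z | m@(suc _) = 3^[1+exponent₃]∤m m m ≤-refl 3^∣z

ν₃-≡⁺ : ∀ {v} z → 3 ^ v ∣ ∣ z ∣ → 3 ^ suc v ∤ ∣ z ∣ → [ v ] ≡ ν₃ z
ν₃-≡⁺ {v} z 3^v∣z 3^∤z with ∣ z ∣
... | zero      = contradiction (_ ∣0) 3^∤z
... | m@(suc _) = cong [_] (≤-antisym
  (≮⇒≥ λ e<v → 3^[1+exponent₃]∤m m m ≤-refl (∣-trans (3^-mono-∣ e<v) 3^v∣z))
  (≮⇒≥ λ v<e → 3^∤z (∣-trans (3^-mono-∣ v<e) (3^exponent₃∣m m m))))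

∣-1^n*x∣ : ∀ n x → ∣ -1ℤ ℤ.^ n ℤ.* + x ∣ ≡ x
∣-1^n*x∣ n x = trans (ℤₚ.abs-* (-1ℤ ℤ.^ n) (+ x)) (trans (cong (_* x) (∣-1^n∣ n)) (*-identityˡ x))
  where
  ∣-1^n∣ : ∀ n → ∣ -1ℤ ℤ.^ n ∣ ≡ 1
  ∣-1^n∣ zero    = refl
  ∣-1^n∣ (suc n) = trans (ℤₚ.abs-* -1ℤ (-1ℤ ℤ.^ n)) (trans (*-identityˡ _) (∣-1^n∣ n))

[s+m*3]/3≡m : ∀ {s} m → s < 3 → (s + m * 3) / 3 ≡ m
[s+m*3]/3≡m {s} m s<3 = trans (+-distrib-/-∣ʳ s (n∣m*n m)) (cong₂ _+_ (m<n⇒m/n≡0 s<3) (m*n/n≡m m 3))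

∣a₃∣ : ∀ {k j} → k < j → ∣ a₃ k j ∣ ≡ 3 ^ k * ∣ δ j (spread (pow k)) 0 ∣
∣a₃∣ {k} {j} k<j = trans (cong ∣_∣ (a₃-multiples k<j))
  (trans (ℤₚ.∣-i∣≡∣i∣ (+ (3 ^ k) ℤ.* δ j (spread (pow k)) 0)) (ℤₚ.abs-* (+ (3 ^ k)) (δ j (spread (pow k)) 0)))

-- Comparison of `a₃ k j` with J! S(k,J), where J = [j/3]

module _ (k j v : ℕ) (k<j : k < j) (3^v∣ : 3 ^ v ∣ (j / 3) !) where

  private
    J = j / 3
    L = δ j (spread (pow k)) 0
    P = -1ℤ ℤ.^ J ℤ.* + (J ! * S k J)

    3^∣L-P : + (3 ^ suc v) ∣ℤ L ℤ.- P
    3^∣L-P = subst₂ (λ x y → + (3 ^ suc v) ∣ℤ δ x (spread (pow k)) 0 ℤ.- y)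
      (sym (trans (m≡m%n+[m/n]*n j 3) (+-comm (j % 3) (J * 3)))) (δ-pow J k)
      (δ-spread-mod J (m%n<n j 3) (λ s → s!∣δ-pow s k) v 3^v∣)

    L≡ : (L ℤ.- P) ℤ.+ P ≡ L
    L≡ = lem L P
      where
      lem : ∀ a b → (a ℤ.- b) ℤ.+ b ≡ a
      lem = ℤ-Solver.solve-∀

    scale : ∀ {w} → 3 ^ w ∣ ∣ L ∣ → 3 ^ (k + w) ∣ ∣ a₃ k j ∣
    scale {w} 3^∣L = subst₂ _∣_ (sym (^-distribˡ-+-* 3 k w)) (sym (∣a₃∣ k<j)) (*-monoʳ-∣ (3 ^ k) 3^∣L)

    unscale : ∀ {w} → 3 ^ (k + w) ∣ ∣ a₃ k j ∣ → 3 ^ w ∣ ∣ L ∣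
    unscale {w} 3^∣a = *-cancelˡ-∣ (3 ^ k) {{m^n≢0 3 k}}
      (subst₂ _∣_ (^-distribˡ-+-* 3 k w) (∣a₃∣ k<j) 3^∣a)

  -- `3 ^ v` divides both `L - P` and `P`, hence `L`; the factor 3^k between `a₃ k j` and `L` adds
  -- `k` to the exponent.
  3^∣a₃ : 3 ^ (k + v) ∣ ∣ a₃ k j ∣
  3^∣a₃ = scale (ℤ∣.∣⇒∣ᵤ {+ (3 ^ v)} {L} (subst (+ (3 ^ v) ∣ℤ_) L≡ (ℤ∣.∣m∣n⇒∣m+n
    (ℤ∣.∣-trans (ℤ∣.∣ᵤ⇒∣ (n∣m*n 3)) 3^∣L-P)
    (ℤ∣.∣ᵤ⇒∣ (subst (3 ^ v ∣_) (sym (∣-1^n*x∣ J _)) (∣m⇒∣m*n (S k J) 3^v∣))))))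

  -- `L` and `P` agree modulo `3 ^ suc v`, so one further power of 3 passes from either to the
  -- other. This direction and its converse below turn the exact valuation of `a₃ k j` into a
  -- condition on J! S(k,J).
  3^∣a₃⇒3^∣J!S : 3 ^ suc (k + v) ∣ ∣ a₃ k j ∣ → 3 ^ suc v ∣ J ! * S k J
  3^∣a₃⇒3^∣J!S 3^∣a = subst (3 ^ suc v ∣_) (∣-1^n*x∣ J _) (ℤ∣.∣⇒∣ᵤ {+ (3 ^ suc v)} {P}
    (ℤ∣.∣m+n∣m⇒∣n (subst (+ (3 ^ suc v) ∣ℤ_) (sym L≡) (ℤ∣.∣ᵤ⇒∣ {i = L} (unscale
      (subst (λ w → 3 ^ w ∣ ∣ a₃ k j ∣) (sym (+-suc k v)) 3^∣a)))) 3^∣L-P))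

  3^∣J!S⇒3^∣a₃ : 3 ^ suc v ∣ J ! * S k J → 3 ^ suc (k + v) ∣ ∣ a₃ k j ∣
  3^∣J!S⇒3^∣a₃ 3^∣J!S = subst (λ w → 3 ^ w ∣ ∣ a₃ k j ∣) (+-suc k v) (scale
    (ℤ∣.∣⇒∣ᵤ {+ (3 ^ suc v)} {L} (subst (+ (3 ^ suc v) ∣ℤ_) L≡ (ℤ∣.∣m∣n⇒∣m+n 3^∣L-P
      (ℤ∣.∣ᵤ⇒∣ (subst (3 ^ suc v ∣_) (sym (∣-1^n*x∣ J _)) 3^∣J!S))))))

-- Attainment of the bound in terms of Stirling numbers modulo 3

module _ (q c d k : ℕ) (c<3 : c < 3) (d<3 : d < 3) (n≡ : suc k ≡ d + (c + q * 3) * 3) where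

  private
    n/3≡ : suc k / 3 ≡ c + q * 3
    n/3≡ = trans (cong (_/ 3) n≡) ([s+m*3]/3≡m (c + q * 3) d<3)

    F = (c + q * 3) !
    v = exponent₃ F F

    instance
      F≢0 : NonZero F
      F≢0 = (c + q * 3) !≢0

    s₃≡ : s₃ (suc k) ≡ [ k + v ]
    s₃≡ = cong ([ k ] +∞_) (trans (cong (λ m → ν₃ (+ (m !))) n/3≡) (exponent₃-NonZero F))

    3^v∣F : 3 ^ v ∣ F
    3^v∣F = 3^exponent₃∣m F F

    3^∤F : 3 ^ suc v ∤ F
    3^∤F = 3^[1+exponent₃]∤m F F ≤-refl

    c+q*3≤j/3 : ∀ {j} → suc k ≤ j → c + q * 3 ≤ j / 3
    c+q*3≤j/3 {j} n≤j = subst (_≤ j / 3) n/3≡ (/-monoˡ-≤ 3 n≤j)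

    3^v∣[j/3]! : ∀ {j} → suc k ≤ j → 3 ^ v ∣ (j / 3) !
    3^v∣[j/3]! n≤j = ∣-trans 3^v∣F (m≤n⇒m!∣n! (c+q*3≤j/3 n≤j))

    -- The factor 3q + 3 supplies one more 3 than (3q+2)!, which `F` divides.
    3^∣[3+q*3]! : 3 ^ suc v ∣ (3 + q * 3) !
    3^∣[3+q*3]! = *-pres-∣ {o = 3} {3 + q * 3} (n∣m*n (suc q)) (∣-trans 3^v∣F (m≤n⇒m!∣n! (+-monoˡ-≤ (q * 3) (≤-pred c<3))))

    -- For s < 3 the factorials (s + 3q)! all equal 3^q q! up to factors prime to 3, so they share
    -- the exponent `v` of `F`.
    3^∤[s+q*3]! : ∀ {s} → s < 3 → 3 ^ suc v ∤ (s + q * 3) !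
    3^∤[s+q*3]! {s} s<3 3^∣ with !-split q s<3 | !-split q c<3
    ... | u , 3∤u , eq | u′ , _ , eq′ = 3^∤F (subst (3 ^ suc v ∣_) (sym eq′)
      (∣m⇒∣m*n {m = 3 ^ q * q !} u′ (3^∣-cancelʳ (suc v) {u} 3∤u (subst (3 ^ suc v ∣_) eq 3^∣))))

  -- The bound `k + v` holds for every j ≥ n, so the minimum equals it iff `3 ^ suc v` fails to
  -- divide J! S(k,J) for some j ≥ n, with J = [j/3]. From J = 3q + 3 on, J! alone is divisible. The
  -- remaining J are s + 3q with c ≤ s < 3; there J! has exponent exactly `v`, and S(k,J) must be
  -- prime to 3.
  criterion : (e₃[ k , suc k ]≡ s₃ (suc k)) ⇔ (∃[ s ] c ≤ s × s < 3 × 3 ∤ S k (s + q * 3))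
  criterion = mk⇔ attained⇒unit unit⇒attained
    where
    attained⇒unit : e₃[ k , suc k ]≡ s₃ (suc k) → ∃[ s ] c ≤ s × s < 3 × 3 ∤ S k (s + q * 3)
    attained⇒unit ((j , n≤j , s₃≡ν) , _) = J % 3 , c≤s , m%n<n J 3 , 3∤S
      where
      J = j / 3
      3^∤J!S : 3 ^ suc v ∤ J ! * S k J
      3^∤J!S = ν₃-≡⁻ (a₃ k j) (trans (sym s₃≡) s₃≡ν) ∘ 3^∣J!S⇒3^∣a₃ k j v n≤j (3^v∣[j/3]! n≤j)
      J/3≡q : J / 3 ≡ q
      J/3≡q with <-cmp (J / 3) q
      ... | tri≈ _ eq _ = eq
      ... | tri< J/3<q _ _ = contradiction
        (subst (_≤ J / 3) ([s+m*3]/3≡m q c<3) (/-monoˡ-≤ 3 (c+q*3≤j/3 n≤j))) (<⇒≱ J/3<q)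
      ... | tri> _ _ q<J/3 = contradiction
        (∣m⇒∣m*n (S k J) (∣-trans 3^∣[3+q*3]! (m≤n⇒m!∣n! (≤-trans (*-monoˡ-≤ 3 q<J/3) (m/n*n≤m J 3))))) 3^∤J!S
      J≡ : J ≡ J % 3 + q * 3
      J≡ = trans (m≡m%n+[m/n]*n J 3) (cong (λ x → J % 3 + x * 3) J/3≡q)
      c≤s : c ≤ J % 3
      c≤s = +-cancelʳ-≤ (q * 3) c (J % 3) (subst (c + q * 3 ≤_) J≡ (c+q*3≤j/3 n≤j))
      3∤S : 3 ∤ S k (J % 3 + q * 3)
      3∤S 3∣S = 3^∤J!S (subst (3 ^ suc v ∣_) (*-comm (S k J) (J !))
        (*-pres-∣ (subst (λ x → 3 ∣ S k x) (sym J≡) 3∣S) (3^v∣[j/3]! n≤j)))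
    unit⇒attained : (∃[ s ] c ≤ s × s < 3 × 3 ∤ S k (s + q * 3)) → e₃[ k , suc k ]≡ s₃ (suc k)
    unit⇒attained (s , c≤s , s<3 , 3∤S) =
      (j , n≤j , trans s₃≡ (ν₃-≡⁺ (a₃ k j) (3^∣a₃ k j v n≤j (3^v∣[j/3]! n≤j))
        (λ 3^∣a → 3^∤[s+q*3]! s<3 (3^∣-cancelʳ (suc v) 3∤S
          (subst (λ J → 3 ^ suc v ∣ J ! * S k J) ([s+m*3]/3≡m (s + q * 3) d<3)
            (3^∣a₃⇒3^∣J!S k j v n≤j (3^v∣[j/3]! n≤j) 3^∣a))))))
      , minimal
      where
      -- Keeping the last digit `d` of n gives [j/3] = s + 3q together with j ≥ n, even when s = c.
      j = d + (s + q * 3) * 3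
      n≤j : suc k ≤ j
      n≤j = subst (_≤ j) (sym n≡) (+-monoʳ-≤ d (*-monoˡ-≤ 3 (+-monoˡ-≤ (q * 3) c≤s)))
      minimal : ∀ w → (∃[ j ] j ≥ suc k × w ≡ ν₃ (a₃ k j)) → s₃ (suc k) ≤∞ w
      minimal _ (j , n≤j , refl) = subst (_≤∞ ν₃ (a₃ k j)) (sym s₃≡)
        (ν₃-≤ (a₃ k j) (3^∣a₃ k j v n≤j (3^v∣[j/3]! n≤j)))

-- Congruence modulo 3

infix 4 _≈_
-- A record instead of a bare equation of remainders, so that `a` and `b` can be inferred from the
-- type.
record _≈_ (a b : ℕ) : Set where
  constructor mod₃
  field a%3≡b%3 : a % 3 ≡ b % 3

≡⇒≈ : ∀ {a b} → a ≡ b → a ≈ b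
≡⇒≈ a≡b = mod₃ (cong (_% 3) a≡b)

≈-trans : ∀ {a b c} → a ≈ b → b ≈ c → a ≈ c
≈-trans (mod₃ a≈b) (mod₃ b≈c) = mod₃ (trans a≈b b≈c)

≈-sym : ∀ {a b} → a ≈ b → b ≈ a
≈-sym (mod₃ a≈b) = mod₃ (sym a≈b)

+-≈ : ∀ {a b c d} → a ≈ b → c ≈ d → a + c ≈ b + d
+-≈ {a} {b} {c} {d} (mod₃ a≈b) (mod₃ c≈d) = mod₃ (trans (%-distribˡ-+ a c 3)
  (trans (cong₂ (λ x y → (x + y) % 3) a≈b c≈d) (sym (%-distribˡ-+ b d 3))))

*-≈ : ∀ a {c d} → c ≈ d → a * c ≈ a * d
*-≈ a {c} {d} (mod₃ c≈d) = mod₃ (trans (%-distribˡ-* a c 3)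
  (trans (cong (λ y → (a % 3 * y) % 3) c≈d) (sym (%-distribˡ-* a d 3))))

≡+*3⇒≈ : ∀ {a} b c → a ≡ b + c * 3 → a ≈ b
≡+*3⇒≈ b c a≡ = mod₃ (trans (cong (_% 3) a≡) ([m+kn]%n≡m%n b c 3))

∤-≈ : ∀ {a b} → a ≈ b → 3 ∤ a → 3 ∤ b
∤-≈ {a} {b} (mod₃ a≈b) 3∤a 3∣b = 3∤a (m%n≡0⇒n∣m a 3 (trans a≈b (n∣m⇒m%n≡0 b 3 3∣b)))

∤⇒≉0 : ∀ {a} → 3 ∤ a → ¬ a ≈ 0
∤⇒≉0 3∤a a≈0 = ∤-≈ a≈0 3∤a (3 ∣0)

-- Stirling numbers modulo 3

-- The complete homogeneous symmetric polynomials h_c(1, …, m).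
h : ℕ → ℕ → ℕ
h m       zero    = 1
h zero    (suc c) = 0
h (suc m) (suc c) = suc m * h (suc m) c + h m (suc c)

S≡h : ∀ m c → S (m + c) m ≡ h m c
S≡h zero    zero    = refl
S≡h zero    (suc c) = refl
S≡h (suc m) zero    = cong₂ _+_ (trans (cong (suc m *_) (k<m⇒S≡0 (s≤s (≤-reflexive (+-identityʳ m))))) (*-zeroʳ m))
                                (S≡h m zero)
S≡h (suc m) (suc c) = cong₂ (λ x y → suc m * x + y)
  (trans (cong (λ k → S k (suc m)) (+-suc m c)) (S≡h (suc m) c)) (S≡h m (suc c))

drop-*3 : ∀ s q x y → (s + q * 3) * x + y ≈ s * x + y
drop-*3 s q x y = ≡+*3⇒≈ (s * x + y) (q * x) (lem s q x y)
  where
  lem : ∀ s q x y → (s + q * 3) * x + y ≡ s * x + y + q * x * 3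
  lem = ℕ-Solver.solve-∀

h-step : ∀ s q c {x y} → h (suc s + q * 3) c ≈ x → h (s + q * 3) (suc c) ≈ y →
         h (suc s + q * 3) (suc c) ≈ suc s * x + y
h-step s q c {x} {y} hx hy = ≈-trans (drop-*3 (suc s) q (h (suc s + q * 3) c) (h (s + q * 3) (suc c)))
  (+-≈ (*-≈ (suc s) hx) hy)

-- C(q+e-1, e), including q = 0.
multichoose : ℕ → ℕ → ℕ
multichoose zero    zero    = 1
multichoose zero    (suc e) = 0
multichoose (suc q) e       = (q + e) C q

pascal : ∀ q e → (q + e) C q + multichoose q (suc e) ≡ (q + suc e) C q
pascal zero    e = trans (+-identityʳ _) (trans (nC0≡1 e) (sym (nC0≡1 (suc e))))
pascal (suc q) e rewrite +-suc q e =
  trans (+-comm (suc (q + e) C suc q) _) (nCk+nC[k+1]≡[n+1]C[k+1] (suc (q + e)) q)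

[q+0]Cq≡1 : ∀ q → (q + 0) C q ≡ 1
[q+0]Cq≡1 q = trans (cong (_C q) (+-identityʳ q)) (nCn≡1 q)

-- The generating function of h_c(1, ..., m) in c is the product of 1/(1 - iz) over i ≤ m, and (1 -
-- z)(1 - 2z) ≡ 1 - z² modulo 3. For m = 3q, 3q + 1, 3q + 2 it is therefore (1 - z²)^(-q), (1 + z)(1
-- - z²)^(-q-1) and (1 - z²)^(-q-1); the six congruences are the even and odd coefficients.
h₀-even : ∀ q e → h (q * 3) (e * 2) ≈ multichoose q e
h₀-odd  : ∀ q e → h (q * 3) (1 + e * 2) ≈ 0
h₁-even : ∀ q e → h (1 + q * 3) (e * 2) ≈ (q + e) C q
h₁-odd  : ∀ q e → h (1 + q * 3) (1 + e * 2) ≈ (q + e) C q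
h₂-even : ∀ q e → h (2 + q * 3) (e * 2) ≈ (q + e) C q
h₂-odd  : ∀ q e → h (2 + q * 3) (1 + e * 2) ≈ 0

h₀-even zero    zero    = ≡⇒≈ refl
h₀-even zero    (suc e) = ≡⇒≈ refl
h₀-even (suc q) zero    = ≡⇒≈ (sym ([q+0]Cq≡1 q))
h₀-even (suc q) (suc e) = ≈-trans (drop-*3 0 (suc q) (h (3 + q * 3) (1 + e * 2)) _) (h₂-even q (suc e))

h₀-odd zero    e = ≡⇒≈ refl
h₀-odd (suc q) e = ≈-trans (drop-*3 0 (suc q) (h (3 + q * 3) (e * 2)) _) (h₂-odd q e)

h₁-even q zero    = ≡⇒≈ (sym ([q+0]Cq≡1 q))
h₁-even q (suc e) = ≈-trans (h-step 0 q (1 + e * 2) (h₁-odd q e) (h₀-even q (suc e)))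
  (≡⇒≈ (trans (cong (_+ multichoose q (suc e)) (*-identityˡ _)) (pascal q e)))

h₁-odd q e = ≈-trans (h-step 0 q (e * 2) (h₁-even q e) (h₀-odd q e))
  (≡⇒≈ (trans (+-identityʳ _) (*-identityˡ _)))

h₂-even q zero    = ≡⇒≈ (sym ([q+0]Cq≡1 q))
h₂-even q (suc e) = h-step 1 q (1 + e * 2) (h₂-odd q e) (h₁-even q (suc e))

h₂-odd q e = ≈-trans (h-step 1 q (e * 2) (h₂-even q e) (h₁-odd q e))
  (≡+*3⇒≈ 0 ((q + e) C q) (lem ((q + e) C q)))
  where
  lem : ∀ x → 2 * x + x ≡ x * 3
  lem = ℕ-Solver.solve-∀

S-≈ : ∀ {k x} m c → suc k ≡ suc (m + c) → h m c ≈ x → S k m ≈ x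
S-≈ m c k≡ hx = ≈-trans (≡⇒≈ (trans (cong (λ k → S k m) (suc-injective k≡)) (S≡h m c))) hx

-- Binomial coefficients modulo 3

absorption : ∀ n k → suc k * (suc n C suc k) ≡ suc n * (n C k)
absorption zero    zero    = refl
absorption zero    (suc k) = *-zeroʳ k
absorption (suc n) zero    = trans (*-identityˡ _) (trans (nC1≡n (2 + n))
  (sym (trans (cong ((2 + n) *_) (nC0≡1 (suc n))) (*-identityʳ (2 + n)))))
absorption (suc n) (suc k) = begin
  (2 + k) * ((2 + n) C (2 + k))
    ≡⟨ cong ((2 + k) *_) (nCk+nC[k+1]≡[n+1]C[k+1] (suc n) (suc k)) ⟨
  (2 + k) * (suc n C suc k + suc n C (2 + k))
    ≡⟨ lem k (suc n C suc k) (suc n C (2 + k)) ⟩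
  suc n C suc k + (suc k * (suc n C suc k) + (2 + k) * (suc n C (2 + k)))
    ≡⟨ cong (λ z → suc n C suc k + z) (cong₂ _+_ (absorption n k) (absorption n (suc k))) ⟩
  suc n C suc k + (suc n * (n C k) + suc n * (n C suc k))
    ≡⟨ cong (λ z → suc n C suc k + z) (trans (sym (*-distribˡ-+ (suc n) (n C k) (n C suc k)))
         (cong (suc n *_) (nCk+nC[k+1]≡[n+1]C[k+1] n k))) ⟩
  suc n C suc k + suc n * (suc n C suc k) ∎
  where
  open ≡-Reasoning
  lem : ∀ k a b → (2 + k) * (a + b) ≡ a + ((1 + k) * a + (2 + k) * b)
  lem = ℕ-Solver.solve-∀

[4+4p]C[1+p] : ∀ p → (suc p + suc p * 3) C suc p ≡ 4 * ((p + suc p * 3) C p)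
[4+4p]C[1+p] p = *-cancelˡ-≡ _ _ (suc p) (trans (absorption (p + suc p * 3) p) (lem p ((p + suc p * 3) C p)))
  where
  lem : ∀ p x → (suc p + suc p * 3) * x ≡ suc p * (4 * x)
  lem = ℕ-Solver.solve-∀

-- With x = C(4p+3,p), absorption gives C(4p+4,p+1) = 4x, and Pascal's rule leaves 4x - x = 3x.
[3+4p]C[1+p]≈0 : ∀ p → (suc p + (2 + p * 3)) C suc p ≈ 0
[3+4p]C[1+p]≈0 p = ≡+*3⇒≈ 0 x (+-cancelˡ-≡ x _ _ (begin
  x + (suc p + (2 + p * 3)) C suc p
    ≡⟨ cong (λ n → x + n C suc p) (+-suc p (2 + p * 3)) ⟨
  x + (p + suc p * 3) C suc p
    ≡⟨ nCk+nC[k+1]≡[n+1]C[k+1] (p + suc p * 3) p ⟩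
  (suc p + suc p * 3) C suc p
    ≡⟨ [4+4p]C[1+p] p ⟩
  4 * x
    ≡⟨ cong (λ z → x + z) (*-comm 3 x) ⟩
  x + x * 3 ∎))
  where
  open ≡-Reasoning
  x = (p + suc p * 3) C p

-- This is (1 + z)³ ≡ 1 + z³ modulo 3, read off at the coefficient of z^(m+3).
pascal³ : ∀ n m → (3 + n) C (3 + m) ≈ n C (3 + m) + n C m
pascal³ n m = ≡+*3⇒≈ _ (n C (1 + m) + n C (2 + m)) (begin
  (3 + n) C (3 + m)
    ≡⟨ P (2 + n) (2 + m) ⟨
  (2 + n) C (2 + m) + (2 + n) C (3 + m)
    ≡⟨ cong₂ _+_ (P (1 + n) (1 + m)) (P (1 + n) (2 + m)) ⟨
  (1 + n) C (1 + m) + (1 + n) C (2 + m) + ((1 + n) C (2 + m) + (1 + n) C (3 + m))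
    ≡⟨ cong₂ _+_ (cong₂ _+_ (P n m) (P n (1 + m))) (cong₂ _+_ (P n (1 + m)) (P n (2 + m))) ⟨
  n C m + n C (1 + m) + (n C (1 + m) + n C (2 + m)) + (n C (1 + m) + n C (2 + m) + (n C (2 + m) + n C (3 + m)))
    ≡⟨ lem (n C m) (n C (1 + m)) (n C (2 + m)) (n C (3 + m)) ⟩
  n C (3 + m) + n C m + (n C (1 + m) + n C (2 + m)) * 3 ∎)
  where
  open ≡-Reasoning
  P = nCk+nC[k+1]≡[n+1]C[k+1]
  lem : ∀ a b c d → a + b + (b + c) + (b + c + (c + d)) ≡ d + a + (b + c) * 3
  lem = ℕ-Solver.solve-∀

[3+n]Cy≈nCy : ∀ n {y} → y < 3 → (3 + n) C y ≈ n C y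
[3+n]Cy≈nCy n {0} _ = ≡⇒≈ (trans (nC0≡1 (3 + n)) (sym (nC0≡1 n)))
[3+n]Cy≈nCy n {1} _ = ≡+*3⇒≈ (n C 1) 1 (trans (nC1≡n (3 + n)) (trans (+-comm 3 n) (cong (_+ 3) (sym (nC1≡n n)))))
[3+n]Cy≈nCy n {2} _ = ≡+*3⇒≈ (n C 2) (n + 1) (begin
  (3 + n) C 2
    ≡⟨ P (2 + n) 1 ⟨
  (2 + n) C 1 + (2 + n) C 2
    ≡⟨ cong₂ _+_ (nC1≡n (2 + n)) (sym (P (1 + n) 1)) ⟩
  2 + n + ((1 + n) C 1 + (1 + n) C 2)
    ≡⟨ cong (λ z → 2 + n + z) (cong₂ _+_ (nC1≡n (1 + n)) (sym (P n 1))) ⟩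
  2 + n + (1 + n + (n C 1 + n C 2))
    ≡⟨ cong (λ x → 2 + n + (1 + n + (x + n C 2))) (nC1≡n n) ⟩
  2 + n + (1 + n + (n + n C 2))
    ≡⟨ lem n (n C 2) ⟩
  n C 2 + (n + 1) * 3 ∎)
  where
  open ≡-Reasoning
  P = nCk+nC[k+1]≡[n+1]C[k+1]
  lem : ∀ n x → 2 + n + (1 + n + (n + x)) ≡ x + (n + 1) * 3
  lem = ℕ-Solver.solve-∀
[3+n]Cy≈nCy n {suc (suc (suc _))} (s≤s (s≤s (s≤s ())))

x+[3+n] : ∀ x n → x + (3 + n) ≡ 3 + (x + n)
x+[3+n] = ℕ-Solver.solve-∀

-- Lucas' theorem for the last digit: (1 + z)^(x+3a) ≡ (1 + z)^x (1 + z³)^a. The induction splits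
-- off one factor 1 + z³ at a time, and Pascal's rule for `a C b` reassembles the result.
lucas : ∀ a b {x y} → x < 3 → y < 3 → (x + a * 3) C (y + b * 3) ≈ (a C b) * (x C y)
lucas zero zero {x} {y} _ _ = ≡⇒≈ (trans (cong₂ _C_ (+-identityʳ x) (+-identityʳ y)) (sym (*-identityˡ _)))
lucas zero (suc b) {x} {y} x<3 _ = ≡⇒≈ (k>n⇒nCk≡0
  (subst (_< y + suc b * 3) (sym (+-identityʳ x)) (≤-trans x<3 (≤-trans (m≤m+n 3 (b * 3)) (m≤n+m (suc b * 3) y)))))
lucas (suc a) zero {x} {y} x<3 y<3 =
  ≈-trans (≡⇒≈ (cong (_C (y + 0)) (x+[3+n] x (a * 3))))
  (≈-trans ([3+n]Cy≈nCy (x + a * 3) (subst (_< 3) (sym (+-identityʳ y)) y<3))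
  (≈-trans (lucas a zero x<3 y<3)
           (≡⇒≈ (cong (_* (x C y)) (trans (nC0≡1 a) (sym (nC0≡1 (suc a))))))))
lucas (suc a) (suc b) {x} {y} x<3 y<3 =
  ≈-trans (≡⇒≈ (cong₂ _C_ (x+[3+n] x (a * 3)) (x+[3+n] y (b * 3))))
  (≈-trans (pascal³ (x + a * 3) (y + b * 3))
  (≈-trans (+-≈ (≈-trans (≡⇒≈ (cong ((x + a * 3) C_) (sym (x+[3+n] y (b * 3))))) (lucas a (suc b) x<3 y<3))
                (lucas a b x<3 y<3))
           (≡⇒≈ (trans (sym (*-distribʳ-+ (x C y) (a C suc b) (a C b)))
             (cong (_* (x C y)) (trans (+-comm (a C suc b) (a C b)) (nCk+nC[k+1]≡[n+1]C[k+1] a b)))))))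

-- The addition of q and 3q + s in base 3 has no carries.
Carryless : ℕ → ℕ → Set
Carryless q s = 3 ∤ (q + (s + q * 3)) C q

3∤sCd : ∀ {d} s → d + s < 3 → 3 ∤ (d + s) C d
3∤sCd {0} 0 _ = 3∤1
3∤sCd {0} 1 _ = 3∤1
3∤sCd {0} 2 _ = 3∤1
3∤sCd {1} 0 _ = 3∤1
3∤sCd {1} 1 _ = 3∤2
3∤sCd {2} 0 _ = 3∤1
3∤sCd {0} (suc (suc (suc _))) (s≤s (s≤s (s≤s ())))
3∤sCd {1} (suc (suc _)) (s≤s (s≤s (s≤s ())))
3∤sCd {2} (suc _) (s≤s (s≤s (s≤s ())))
3∤sCd {suc (suc (suc _))} _ (s≤s (s≤s (s≤s ())))

-- The last digits added are `d` and `s`. Without a carry, Lucas splits off C(d+s,d), which is prime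
-- to 3, and what remains is the addition of `q` and 3q + d.
carryless-step : ∀ q {s d} → s < 3 → d < 3 → Carryless (d + q * 3) s ⇔ (s + d < 3 × Carryless q d)
carryless-step q {s} {d} s<3 d<3 with s + d <? 3
... | yes s+d<3 = mk⇔
  (λ 3∤ → s+d<3 , λ 3∣ → ∤-≈ C≈ 3∤ (∣m⇒∣m*n _ 3∣))
  (λ (_ , 3∤) → ∤-≈ (≈-sym C≈) (3∤* 3∤ (3∤sCd s d+s<3)))
  where
  d+s<3 : d + s < 3
  d+s<3 = subst (_< 3) (+-comm s d) s+d<3
  lem : ∀ d s q → d + q * 3 + (s + (d + q * 3) * 3) ≡ d + s + (q + (d + q * 3)) * 3
  lem = ℕ-Solver.solve-∀
  C≈ : (d + q * 3 + (s + (d + q * 3) * 3)) C (d + q * 3) ≈ ((q + (d + q * 3)) C q) * ((d + s) C d)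
  C≈ = ≈-trans (≡⇒≈ (cong (_C (d + q * 3)) (lem d s q))) (lucas (q + (d + q * 3)) q d+s<3 d<3)
... | no s+d≮3 = mk⇔ (λ 3∤ → contradiction C≈0 (∤⇒≉0 3∤)) (λ (s+d<3 , _) → contradiction s+d<3 s+d≮3)
  where
  -- The last digit of the sum after the carry. It is below `d` because s < 3, so the Lucas factor
  -- C(x,d) vanishes.
  x = s + d ∸ 3
  3+x≡ : 3 + x ≡ s + d
  3+x≡ = m+[n∸m]≡n (≮⇒≥ s+d≮3)
  x<d : x < d
  x<d = +-cancelˡ-< 3 x d (subst (_< 3 + d) (sym 3+x≡) (+-monoˡ-< d s<3))
  lem : ∀ d s q → d + q * 3 + (s + (d + q * 3) * 3) ≡ s + d + (q + (d + q * 3)) * 3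
  lem = ℕ-Solver.solve-∀
  lem′ : ∀ x m → 3 + x + m * 3 ≡ x + suc m * 3
  lem′ = ℕ-Solver.solve-∀
  m = q + (d + q * 3)
  C≈0 : (d + q * 3 + (s + (d + q * 3) * 3)) C (d + q * 3) ≈ 0
  C≈0 = ≈-trans (≡⇒≈ (cong (_C (d + q * 3))
          (trans (lem d s q) (trans (cong (_+ m * 3) (sym 3+x≡)) (lem′ x m)))))
    (≈-trans (lucas (suc m) q (<-trans x<d d<3) d<3)
      (≡⇒≈ (trans (cong ((suc m C q) *_) (k>n⇒nCk≡0 x<d)) (*-zeroʳ (suc m C q)))))

-- The digit condition as carryless addition

divMod-unique : ∀ {a b m n} → a < 3 → b < 3 → a + m * 3 ≡ b + n * 3 → a ≡ b × m ≡ n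
divMod-unique {a} {b} {m} {n} a<3 b<3 eq = +-cancelʳ-≡ (m * 3) a b
  (trans eq (cong (λ z → b + z * 3) (sym m≡n))) , m≡n
  where
  m≡n = trans (sym ([s+m*3]/3≡m m a<3)) (trans (cong (_/ 3) eq) ([s+m*3]/3≡m n b<3))

ConsecutiveSums<3 : List (Fin 3) → Set
ConsecutiveSums<3 = Linked (λ d d′ → toℕ d + toℕ d′ < 3)

-- Adding the number with digits `ds` to the one with digits `d ∷ ds` places each digit over its
-- neighbour, so the absence of carries is the condition on consecutive sums.
linked⇔carryless : ∀ d ds → ConsecutiveSums<3 (d ∷ ds) ⇔ Carryless (fromDigits ds) (toℕ d)
linked⇔carryless d []        = mk⇔ (λ _ → subst (3 ∤_) (sym (nC0≡1 (toℕ d + 0))) 3∤1) (λ _ → [-])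
linked⇔carryless d (d′ ∷ ds) = mk⇔
  (λ { (d+d′<3 Linked.∷ linked) → from step (d+d′<3 , to rec linked) })
  (λ 3∤ → proj₁ (to step 3∤) Linked.∷ from rec (proj₂ (to step 3∤)))
  where
  step = carryless-step (fromDigits ds) (toℕ<n d) (toℕ<n d′)
  rec = linked⇔carryless d′ ds

-- Stated for every digit list of the given value, so that `toDigits` enters through its correctness
-- proof.
expansion⇔carryless : ∀ ds q {s} → s < 3 → fromDigits ds ≡ s + q * 3 → ConsecutiveSums<3 ds ⇔ Carryless q s
expansion⇔carryless []       q {s} s<3 eq with divMod-unique {0} {s} {0} {q} (s≤s z≤n) s<3 eq
... | refl , refl = mk⇔ (λ _ → 3∤1) (λ _ → Linked.[])
expansion⇔carryless (d ∷ ds) q s<3 eq with divMod-unique {m = fromDigits ds} {q} (toℕ<n d) s<3 eq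
... | refl , refl = linked⇔carryless d ds

T⇔carryless : ∀ q {s} → s < 3 → T (s + q * 3) ⇔ Carryless q s
T⇔carryless q {s} s<3 = expansion⇔carryless (proj₁ (toDigits 3 (s + q * 3))) q s<3 (proj₂ (toDigits 3 (s + q * 3)))

-- Appending a digit 0 to an expansion does not affect the digit condition.
T⇔carryless-0 : ∀ t → T t ⇔ Carryless t 0
T⇔carryless-0 t = subst (λ t → T t ⇔ Carryless t 0) (sym (m≡m%n+[m/n]*n t 3)) (mk⇔
  (λ t∈T → from step (m%n<n t 3 , to T⇔ t∈T)) (λ 3∤ → from T⇔ (proj₂ (to step 3∤))))
  where
  step = carryless-step (t / 3) {0} {t % 3} (s≤s z≤n) (m%n<n t 3)
  T⇔ = T⇔carryless (t / 3) (m%n<n t 3)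

-- The three families in terms of the last two digits of n

data Good (q : ℕ) : (c d : ℕ) → Set where
  3T+1  : ∀ {c} → Carryless q c → Good q c 1
  3T′+2 : ∀ {c} → c ≢ 2 → Carryless q c → Good q c 2
  9T+3  : Carryless q 0 → Good q 1 0

∈⇔good : ∀ q {c d} → c < 3 → d < 3 →
  (d + (c + q * 3) * 3 ∈ (3 ⟨ T ⟩+ 1) ∪ (3 ⟨ T′ ⟩+ 2) ∪ (9 ⟨ T ⟩+ 3)) ⇔ Good q c d
∈⇔good q {c} {d} c<3 d<3 = mk⇔ to′ from′
  where
  T⇔ = T⇔carryless q c<3
  3t+b : ∀ t b → 3 * t + b ≡ b + t * 3
  3t+b = ℕ-Solver.solve-∀
  9t+3 : ∀ t → 9 * t + 3 ≡ 0 + (1 + t * 3) * 3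
  9t+3 = ℕ-Solver.solve-∀
  [c+q*3]%3≡c : (c + q * 3) % 3 ≡ c
  [c+q*3]%3≡c = trans ([m+kn]%n≡m%n c q 3) (m<n⇒m%n≡m c<3)
  to′ : _ → Good q c d
  to′ (inj₁ (t , t∈T , eq)) with divMod-unique {d} {1} {c + q * 3} {t} d<3 (s≤s (s≤s z≤n)) (trans eq (3t+b t 1))
  ... | refl , refl = 3T+1 (to T⇔ t∈T)
  to′ (inj₂ (inj₁ (t , (t∈T , t%3≢2) , eq)))
    with divMod-unique {d} {2} {c + q * 3} {t} d<3 (s≤s (s≤s (s≤s z≤n))) (trans eq (3t+b t 2))
  ... | refl , refl = 3T′+2 (t%3≢2 ∘ trans [c+q*3]%3≡c) (to T⇔ t∈T)
  to′ (inj₂ (inj₂ (t , t∈T , eq)))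
    with divMod-unique {d} {0} {c + q * 3} {1 + t * 3} d<3 (s≤s z≤n) (trans eq (9t+3 t))
  ... | refl , c+q*3≡ with divMod-unique {c} {1} {q} {t} c<3 (s≤s (s≤s z≤n)) c+q*3≡
  ...   | refl , refl = 9T+3 (to (T⇔carryless-0 t) t∈T)
  from′ : Good q c d → _
  from′ (3T+1 carryless)      = inj₁ (c + q * 3 , from T⇔ carryless , sym (3t+b (c + q * 3) 1))
  from′ (3T′+2 c≢2 carryless) =
    inj₂ (inj₁ (c + q * 3 , (from T⇔ carryless , c≢2 ∘ trans (sym [c+q*3]%3≡c)) , sym (3t+b (c + q * 3) 2)))
  from′ (9T+3 carryless)      = inj₂ (inj₂ (q , from (T⇔carryless-0 q) carryless , sym (9t+3 q)))

-- Case analysis over the last digits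

data Ternary : ℕ → Set where
  0₃ : Ternary 0
  1₃ : Ternary 1
  2₃ : Ternary 2

ternary : ∀ {n} → n < 3 → Ternary n
ternary {0} _ = 0₃
ternary {1} _ = 1₃
ternary {2} _ = 2₃
ternary {suc (suc (suc _))} (s≤s (s≤s (s≤s ())))

-- For q ≥ 1 this compares C(4q-1,q-1) with C(4q,q), which is four times as large.
multichoose≈ : ∀ q → multichoose q (q * 3) ≈ (q + q * 3) C q
multichoose≈ zero    = ≡⇒≈ refl
multichoose≈ (suc p) = ≈-sym (≡+*3⇒≈ x x (trans ([4+4p]C[1+p] p) (cong (λ z → x + z) (*-comm 3 x))))
  where
  x = (p + suc p * 3) C p

-- Here k = m + e′ with m = s + 3q and e′ = 6q + 3c + d - 1 - s, and S(k,m) is h_(e′)(1, ..., m).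
-- The parity of e′ selects one of the six congruences: the value is zero modulo 3, or it is the
-- binomial coefficient of the matching constructor of `Good` up to a unit.
unit⇒good : ∀ q {c d s k} → Ternary c → Ternary d → Ternary s → c ≤ s →
            suc k ≡ d + (c + q * 3) * 3 → 3 ∤ S k (s + q * 3) → Good q c d
unit⇒good zero    0₃ 0₃ _  _ () _
-- For c = d = 0 the index e′ is 6q - 1 - s, written without subtraction by setting q = p + 1.
unit⇒good (suc p) 0₃ 0₃ 0₃ _ k≡ 3∤S = contradiction
  (S-≈ (suc p * 3) (1 + (2 + p * 3) * 2) (trans k≡ (ℕ-Solver.solve (p ∷ []))) (h₀-odd (suc p) (2 + p * 3))) (∤⇒≉0 3∤S)
unit⇒good (suc p) 0₃ 0₃ 1₃ _ k≡ 3∤S = contradiction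
  (S-≈ (1 + suc p * 3) ((2 + p * 3) * 2) (trans k≡ (ℕ-Solver.solve (p ∷ [])))
    (≈-trans (h₁-even (suc p) (2 + p * 3)) ([3+4p]C[1+p]≈0 p))) (∤⇒≉0 3∤S)
unit⇒good (suc p) 0₃ 0₃ 2₃ _ k≡ 3∤S = contradiction
  (S-≈ (2 + suc p * 3) (1 + (1 + p * 3) * 2) (trans k≡ (ℕ-Solver.solve (p ∷ []))) (h₂-odd (suc p) (1 + p * 3))) (∤⇒≉0 3∤S)
unit⇒good q 0₃ 1₃ 0₃ _ k≡ 3∤S = 3T+1 (∤-≈
  (S-≈ (q * 3) (q * 3 * 2) (trans k≡ (ℕ-Solver.solve (q ∷ []))) (≈-trans (h₀-even q (q * 3)) (multichoose≈ q))) 3∤S)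
-- For q = 0 this has k = 0 < s, and the Stirling number itself is zero.
unit⇒good zero 0₃ 1₃ 1₃ _ refl 3∤S = contradiction (3 ∣0) 3∤S
unit⇒good zero 0₃ 1₃ 2₃ _ refl 3∤S = contradiction (3 ∣0) 3∤S
unit⇒good (suc p) 0₃ 1₃ 1₃ _ k≡ 3∤S = contradiction
  (S-≈ (1 + suc p * 3) (1 + (2 + p * 3) * 2) (trans k≡ (ℕ-Solver.solve (p ∷ [])))
    (≈-trans (h₁-odd (suc p) (2 + p * 3)) ([3+4p]C[1+p]≈0 p))) (∤⇒≉0 3∤S)
unit⇒good (suc p) 0₃ 1₃ 2₃ _ k≡ 3∤S = contradiction
  (S-≈ (2 + suc p * 3) ((2 + p * 3) * 2) (trans k≡ (ℕ-Solver.solve (p ∷ [])))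
    (≈-trans (h₂-even (suc p) (2 + p * 3)) ([3+4p]C[1+p]≈0 p))) (∤⇒≉0 3∤S)
unit⇒good q 0₃ 2₃ 0₃ _ k≡ 3∤S = contradiction
  (S-≈ (q * 3) (1 + q * 3 * 2) (trans k≡ (ℕ-Solver.solve (q ∷ []))) (h₀-odd q (q * 3))) (∤⇒≉0 3∤S)
unit⇒good q 0₃ 2₃ 1₃ _ k≡ 3∤S = 3T′+2 (λ ()) (∤-≈
  (S-≈ (1 + q * 3) (q * 3 * 2) (trans k≡ (ℕ-Solver.solve (q ∷ []))) (h₁-even q (q * 3))) 3∤S)
unit⇒good zero 0₃ 2₃ 2₃ _ refl 3∤S = contradiction (3 ∣0) 3∤S
unit⇒good (suc p) 0₃ 2₃ 2₃ _ k≡ 3∤S = contradiction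
  (S-≈ (2 + suc p * 3) (1 + (2 + p * 3) * 2) (trans k≡ (ℕ-Solver.solve (p ∷ []))) (h₂-odd (suc p) (2 + p * 3))) (∤⇒≉0 3∤S)
unit⇒good q 1₃ 0₃ 1₃ _ k≡ 3∤S = 9T+3 (∤-≈
  (S-≈ (1 + q * 3) (1 + q * 3 * 2) (trans k≡ (ℕ-Solver.solve (q ∷ []))) (h₁-odd q (q * 3))) 3∤S)
unit⇒good q 1₃ 0₃ 2₃ _ k≡ 3∤S = 9T+3 (∤-≈
  (S-≈ (2 + q * 3) (q * 3 * 2) (trans k≡ (ℕ-Solver.solve (q ∷ []))) (h₂-even q (q * 3))) 3∤S)
unit⇒good q 1₃ 1₃ 1₃ _ k≡ 3∤S = 3T+1 (∤-≈
  (S-≈ (1 + q * 3) ((1 + q * 3) * 2) (trans k≡ (ℕ-Solver.solve (q ∷ []))) (h₁-even q (1 + q * 3))) 3∤S)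
unit⇒good q 1₃ 1₃ 2₃ _ k≡ 3∤S = contradiction
  (S-≈ (2 + q * 3) (1 + q * 3 * 2) (trans k≡ (ℕ-Solver.solve (q ∷ []))) (h₂-odd q (q * 3))) (∤⇒≉0 3∤S)
unit⇒good q 1₃ 2₃ 1₃ _ k≡ 3∤S = 3T′+2 (λ ()) (∤-≈
  (S-≈ (1 + q * 3) (1 + (1 + q * 3) * 2) (trans k≡ (ℕ-Solver.solve (q ∷ []))) (h₁-odd q (1 + q * 3))) 3∤S)
unit⇒good q 1₃ 2₃ 2₃ _ k≡ 3∤S = 3T′+2 (λ ()) (∤-≈
  (S-≈ (2 + q * 3) ((1 + q * 3) * 2) (trans k≡ (ℕ-Solver.solve (q ∷ []))) (h₂-even q (1 + q * 3))) 3∤S)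
unit⇒good q 2₃ 0₃ 2₃ _ k≡ 3∤S = contradiction
  (S-≈ (2 + q * 3) (1 + (1 + q * 3) * 2) (trans k≡ (ℕ-Solver.solve (q ∷ []))) (h₂-odd q (1 + q * 3))) (∤⇒≉0 3∤S)
unit⇒good q 2₃ 1₃ 2₃ _ k≡ 3∤S = 3T+1 (∤-≈
  (S-≈ (2 + q * 3) ((2 + q * 3) * 2) (trans k≡ (ℕ-Solver.solve (q ∷ []))) (h₂-even q (2 + q * 3))) 3∤S)
-- With c = 2 only s = 2 is available, and e′ = 6q + 5 is odd; this is why `T′` leaves out the
-- residue 2.
unit⇒good q 2₃ 2₃ 2₃ _ k≡ 3∤S = contradiction
  (S-≈ (2 + q * 3) (1 + (2 + q * 3) * 2) (trans k≡ (ℕ-Solver.solve (q ∷ []))) (h₂-odd q (2 + q * 3))) (∤⇒≉0 3∤S)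
unit⇒good q 1₃ _ 0₃ () _ _
unit⇒good q 2₃ _ 0₃ () _ _
unit⇒good q 2₃ _ 1₃ (s≤s ()) _ _

good⇒unit : ∀ q {c d k} → Ternary c → suc k ≡ d + (c + q * 3) * 3 → Good q c d →
            ∃[ s ] c ≤ s × s < 3 × 3 ∤ S k (s + q * 3)
good⇒unit q 0₃ k≡ (3T+1 3∤C) = 0 , z≤n , s≤s z≤n , ∤-≈ (≈-sym
  (S-≈ (q * 3) (q * 3 * 2) (trans k≡ (ℕ-Solver.solve (q ∷ []))) (≈-trans (h₀-even q (q * 3)) (multichoose≈ q)))) 3∤C
good⇒unit q 1₃ k≡ (3T+1 3∤C) = 1 , ≤-refl , s≤s (s≤s z≤n) , ∤-≈ (≈-sym
  (S-≈ (1 + q * 3) ((1 + q * 3) * 2) (trans k≡ (ℕ-Solver.solve (q ∷ []))) (h₁-even q (1 + q * 3)))) 3∤C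
good⇒unit q 2₃ k≡ (3T+1 3∤C) = 2 , ≤-refl , ≤-refl , ∤-≈ (≈-sym
  (S-≈ (2 + q * 3) ((2 + q * 3) * 2) (trans k≡ (ℕ-Solver.solve (q ∷ []))) (h₂-even q (2 + q * 3)))) 3∤C
-- The one case where s = c fails: for s = 0 the index 6q + 1 is odd and the Stirling number
-- vanishes modulo 3, so s = 1 is taken.
good⇒unit q 0₃ k≡ (3T′+2 _ 3∤C) = 1 , z≤n , s≤s (s≤s z≤n) , ∤-≈ (≈-sym
  (S-≈ (1 + q * 3) (q * 3 * 2) (trans k≡ (ℕ-Solver.solve (q ∷ []))) (h₁-even q (q * 3)))) 3∤C
good⇒unit q 1₃ k≡ (3T′+2 _ 3∤C) = 1 , ≤-refl , s≤s (s≤s z≤n) , ∤-≈ (≈-sym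
  (S-≈ (1 + q * 3) (1 + (1 + q * 3) * 2) (trans k≡ (ℕ-Solver.solve (q ∷ []))) (h₁-odd q (1 + q * 3)))) 3∤C
good⇒unit q 2₃ refl (3T′+2 2≢2 _) = contradiction refl 2≢2
good⇒unit q 1₃ k≡ (9T+3 3∤C) = 1 , ≤-refl , s≤s (s≤s z≤n) , ∤-≈ (≈-sym
  (S-≈ (1 + q * 3) (1 + q * 3 * 2) (trans k≡ (ℕ-Solver.solve (q ∷ []))) (h₁-odd q (q * 3)))) 3∤C

theorem1p9 : (n : ℕ) → 1 ≤ n →
    (e₃[ n ∸ 1 , n ]≡ s₃ n) ⇔ (n ∈ (3 ⟨ T ⟩+ 1) ∪ (3 ⟨ T′ ⟩+ 2) ∪ (9 ⟨ T ⟩+ 3))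
theorem1p9 n@(suc k) _ =
  (⇔-sym (subst (λ m → (m ∈ (3 ⟨ T ⟩+ 1) ∪ (3 ⟨ T′ ⟩+ 2) ∪ (9 ⟨ T ⟩+ 3)) ⇔ Good q c d) (sym n≡) (∈⇔good q c<3 d<3))
  ⇔-∘ mk⇔ (λ (_ , c≤s , s<3 , 3∤S) → unit⇒good q (ternary c<3) (ternary d<3) (ternary s<3) c≤s n≡ 3∤S)
          (good⇒unit q (ternary c<3) n≡))
  ⇔-∘ criterion q c d k c<3 d<3 n≡
  where
  d = n % 3
  c = n / 3 % 3
  q = n / 3 / 3
  d<3 : d < 3
  d<3 = m%n<n n 3
  c<3 : c < 3
  c<3 = m%n<n (n / 3) 3
  n≡ : n ≡ d + (c + q * 3) * 3
  n≡ = trans (m≡m%n+[m/n]*n n 3) (cong (λ m → d + m * 3) (m≡m%n+[m/n]*n (n / 3) 3))
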